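{- Let $q>2$ be a prime power and let $\mathcal{V},\mathcal{V}'$ be two Veronese surfaces of $\mathrm{PG}(5,q)$ such that their chordal varieties are disjoint if $q$ is odd, or, if $q$ is even, $\mathcal{V}$ and $\mathcal{V}'$ have a common nuclear plane and their chordal varieties meet only in points of this plane. Then $\mathcal{V}\cup\mathcal{V}'$ is a complete cap of $\mathrm{PG}(5,q)$.
   Context: A Veronese surface of $\mathrm{PG}(5,q)$ is a projective image of the standard Veronese variety, i.e. of the set of points $\langle (x_0^2,x_1^2,x_2^2,x_0x_1,x_0x_2,x_1x_2)\rangle$, $(x_0,x_1,x_2)\ne 0$; equivalently, of the rank-$1$ points of the projective space of $3\times3$ symmetric matrices over $\mathbb{F}_q$. Its chordal variety is the corresponding image of the set of points of rank at most $2$ (zeros of the determinant). For $q$ even, the nuclear plane of a Veronese surface is the plane containing the nuclei of all its conics. A cap is a set of points no three collinear; it is complete if not contained in a larger cap. -}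

module Defs where

open import Level using (0ℓ)
open import Data.Nat using (ℕ; zero; suc)
open import Data.Fin using (Fin; zero; suc)
open import Data.Product using (Σ; ∃; ∃-syntax; _×_; _,_)
open import Data.Sum using (_⊎_)
open import Relation.Nullary using (¬_)
open import Relation.Binary.PropositionalEquality using (_≡_)
open import Algebra.Bundles using (CommutativeRing)

record FiniteField (q : ℕ) : Set₁ where
  field
    commRing : CommutativeRing 0ℓ 0ℓ
  open CommutativeRing commRing public using (Carrier; _≈_; _+_; _*_; -_; _-_; 0#; 1#)
  field
    0≉1     : ¬ (0# ≈ 1#)
    inverse : ∀ x → ¬ (x ≈ 0#) → ∃[ y ] (x * y ≈ 1#)
    enum    : Fin q → Carrier
    enum-surj : ∀ x → ∃[ i ] (enum i ≈ x)
    enum-inj  : ∀ i j → enum i ≈ enum j → i ≡ j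

module Geometry {q : ℕ} (F : FiniteField q) where
  open FiniteField F

  -- vectors of F^n (coordinates of points of PG(n-1,q))
  Vect : ℕ → Set
  Vect n = Fin n → Carrier

  Σ[_] : ∀ {k} → (Fin k → Carrier) → Carrier
  Σ[_] {zero}  f = 0#
  Σ[_] {suc k} f = f zero + Σ[ (λ i → f (suc i)) ]

  _≈ᵥ_ : ∀ {n} → Vect n → Vect n → Set
  u ≈ᵥ v = ∀ i → u i ≈ v i

  0ᵥ : ∀ {n} → Vect n
  0ᵥ i = 0#

  NonZero : ∀ {n} → Vect n → Set
  NonZero v = ∃[ i ] ¬ (v i ≈ 0#)

  SamePoint : ∀ {n} → Vect n → Vect n → Set
  SamePoint u v = ∃[ c ] (¬ (c ≈ 0#) × (∀ i → u i ≈ c * v i))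

  -- a point set of PG(5,q) is given by a predicate on nonzero vectors of F^6;
  -- all sets below are closed under proportionality by construction.
  PointSet : Set₁
  PointSet = Vect 6 → Set

  Collinear : Vect 6 → Vect 6 → Vect 6 → Set
  Collinear u v w = ∃[ a ] ∃[ b ] ∃[ c ]
    ((¬ (a ≈ 0#) ⊎ ¬ (b ≈ 0#) ⊎ ¬ (c ≈ 0#)) ×
     (∀ i → a * u i + b * v i + c * w i ≈ 0#))

  Cap : PointSet → Set
  Cap S = ∀ u v w → NonZero u → NonZero v → NonZero w → S u → S v → S w →
          ¬ SamePoint u v → ¬ SamePoint u w → ¬ SamePoint v w →
          ¬ Collinear u v w

  Add : PointSet → Vect 6 → PointSet
  Add S p v = S v ⊎ SamePoint v p

  CompleteCap : PointSet → Set
  CompleteCap S = Cap S × (∀ p → NonZero p → ¬ S p → ¬ Cap (Add S p))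

  _∪_ : PointSet → PointSet → PointSet
  (S ∪ T) v = S v ⊎ T v

  Span : PointSet → PointSet
  Span S p = NonZero p × Σ ℕ λ k → Σ (Fin k → Vect 6) λ pts → Σ (Fin k → Carrier) λ coef →
    ((∀ (j : Fin k) → NonZero (pts j) × S (pts j)) ×
     (∀ i → p i ≈ Σ[ (λ j → coef j * pts j i) ]))

  Matrix : Set
  Matrix = Fin 6 → Fin 6 → Carrier

  apply : Matrix → Vect 6 → Vect 6
  apply A v i = Σ[ (λ j → A i j * v j) ]

  Nonsingular : Matrix → Set
  Nonsingular A = ∀ v → apply A v ≈ᵥ 0ᵥ → v ≈ᵥ 0ᵥ

  Image : Matrix → PointSet → PointSet
  Image A S p = ∃[ v ] (NonZero v × S v × SamePoint p (apply A v))

  -- The standard Veronese variety.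
  -- Coordinates (y0,…,y5) correspond to the symmetric matrix
  --   [ y0 y3 y4 ; y3 y1 y5 ; y4 y5 y2 ],
  -- and ν(x) = (x0², x1², x2², x0x1, x0x2, x1x2) corresponds to x xᵀ.

  ν : Vect 3 → Vect 6
  ν x zero = x zero * x zero
  ν x (suc zero) = x (suc zero) * x (suc zero)
  ν x (suc (suc zero)) = x (suc (suc zero)) * x (suc (suc zero))
  ν x (suc (suc (suc zero))) = x zero * x (suc zero)
  ν x (suc (suc (suc (suc zero)))) = x zero * x (suc (suc zero))
  ν x (suc (suc (suc (suc (suc zero))))) = x (suc zero) * x (suc (suc zero))

  StdVeronese : PointSet
  StdVeronese p = ∃[ x ] (NonZero x × SamePoint p (ν x))

  -- determinant of the symmetric matrix [ y0 y3 y4 ; y3 y1 y5 ; y4 y5 y2 ]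
  detSym : Vect 6 → Carrier
  detSym y =
    let a = y zero ; b = y (suc zero) ; c = y (suc (suc zero))
        d = y (suc (suc (suc zero))) ; e = y (suc (suc (suc (suc zero))))
        f = y (suc (suc (suc (suc (suc zero)))))
    in a * (b * c - f * f) - d * (d * c - f * e) + e * (d * f - b * e)

  -- standard chordal variety: points of rank ≤ 2 (zeros of the determinant)
  StdChordal : PointSet
  StdChordal p = NonZero p × detSym p ≈ 0#

  Veronese : Matrix → PointSet
  Veronese A = Image A StdVeronese

  Chordal : Matrix → PointSet
  Chordal A = Image A StdChordal

  -- conics of the Veronese surface Image A StdVeronese: images of the
  -- lines ⟨u,w⟩ of PG(2,q) under x ↦ A ν(x)
  Conic : Matrix → Vect 3 → Vect 3 → PointSet
  Conic A u w p = ∃[ s ] ∃[ t ]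
    (NonZero (λ i → s * u i + t * w i) ×
     SamePoint p (apply A (ν (λ i → s * u i + t * w i))))

  -- nucleus of a conic C: a point N of the plane of C, not on C, lying on
  -- the tangent line at every point P of C (the line NP meets C only in P)
  Nucleus : PointSet → Vect 6 → Set
  Nucleus C N = Span C N × ¬ C N ×
    (∀ P P' → NonZero P' → C P → C P' → Collinear N P P' → SamePoint P P')

  NuclearPlane : Matrix → PointSet
  NuclearPlane A = Span (λ N → ∃[ u ] ∃[ w ] (NonZero u × NonZero w ×
                      ¬ SamePoint u w × Nucleus (Conic A u w) N))

{-# OPTIONS --safe #-}

-- Let K and K′ be the affine cones over the two surfaces. The difference of two vectors of a cone has
-- rank at most 2, so a coincidence u + v = u′ + v′ with u, u′ ∈ K and v, v′ ∈ K′ puts u − u′ = v′ − v in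
-- both chordal varieties. For q odd this forces u = u′ and v = v′. For q even the nuclear plane consists of
-- the matrices with zero diagonal, and a matrix of rank at most 1 is determined by its diagonal because
-- squaring is injective; again u = u′ and v = v′. This uniqueness of sums reduces the cap property to that
-- of a single Veronese surface. Each cone has q³ elements, so (u, v) ↦ u + v is an injective, hence
-- surjective, map from a set of size q⁶ to F⁶: every point off the surfaces lies on a line joining them.
module Submission where

open import Defs
open import Level using (0ℓ)
open import Algebra.Bundles using (CommutativeRing)
open import Data.Empty using (⊥)
open import Data.Fin using (Fin; zero; suc; _↑ˡ_; _↑ʳ_; combine; finToFun; funToFin; punchOut)
open import Data.Fin.Patterns using (0F; 1F; 2F; 3F; 4F; 5F)
open import Data.Fin.Permutation using (permutation)
import Data.Fin.Properties as Finₚ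
open import Data.Integer using (ℤ; +_; -[1+_]; _⊖_)
import Data.Integer as ℤ
import Data.Integer.Properties as ℤₚ
open import Data.Maybe using (Maybe; just; nothing)
open import Data.Nat using (ℕ; zero; suc; _^_; _<_)
import Data.Nat as ℕ
open import Data.Nat.Divisibility using (_∣_; _∣?_; ∣1⇒≡1)
import Data.Nat.Properties as ℕₚ
open import Data.Nat.Primality using (Prime; ¬prime[1]; euclidsLemma; prime⇒irreducible; prime[2])
open import Data.Product using (∃-syntax; _×_; _,_; proj₁; proj₂)
import Data.Product as Product
open import Data.Sum using (_⊎_; inj₁; inj₂; [_,_]′; map; swap)
open import Function using (_∘_)
open import Function.Definitions using (Injective)
open import Relation.Binary.PropositionalEquality as ≡ using (_≡_)
open import Relation.Nullary using (¬_; Dec; yes; no; contradiction)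
open import Relation.Nullary.Decidable using (¬?; decidable-stable)

-- The argument runs on vectors rather than points. The cones contain 0 and are closed under
-- scalars, so a linear relation involving both surfaces becomes a coincidence of two sums once a
-- term is moved across and 0 fills the missing place. The count cannot take `ν` itself as
-- parametrisation of a cone: for q odd, `ν` identifies x with -x and misses the nonsquare multiples
-- of its values. Dividing `ν x` by the first nonzero coordinate of x repairs both defects, because
-- x then reappears as a row of the matrix. For q even the nuclear plane is defined through tangent
-- lines, and zero diagonals have to be extracted from that. A point of a conic plane with a nonzero
-- component along `ν u` or `ν w` lies on a line that meets the conic twice; finding the second
-- point takes a square root.

module IntegerSolver (R : CommutativeRing 0ℓ 0ℓ) where
  open CommutativeRing R hiding (zero)
  open import Algebra.Properties.Monoid.Mult +-monoid using (×-homo-+) renaming (_×_ to _×′_)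
  open import Algebra.Properties.Semiring.Mult semiring using (×1-homo-*)
  open import Algebra.Properties.Ring ring
    using (-0#≈0#; -‿distribˡ-*; -‿distribʳ-*; -‿+-comm; -‿involutive)
  open import Algebra.Solver.Ring.AlmostCommutativeRing
  open import Relation.Binary.Reasoning.Setoid setoid

  -- Coefficients are taken in ℤ, where equality is decidable, so that the solver recognises
  -- cancelling terms over any commutative ring.
  ⟦_⟧ℤ : ℤ → Carrier
  ⟦ + n ⟧ℤ      = n ×′ 1#
  ⟦ -[1+ n ] ⟧ℤ = - (suc n ×′ 1#)

  ⟦⟧-⊖ : ∀ m n → ⟦ m ⊖ n ⟧ℤ ≈ m ×′ 1# - n ×′ 1#
  ⟦⟧-⊖ m zero = begin
    m ×′ 1#         ≈⟨ +-identityʳ _ ⟨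
    m ×′ 1# + 0#    ≈⟨ +-congˡ -0#≈0# ⟨
    m ×′ 1# - 0#    ∎
  ⟦⟧-⊖ zero (suc n) = sym (+-identityˡ _)
  ⟦⟧-⊖ (suc m) (suc n) = begin
    ⟦ suc m ⊖ suc n ⟧ℤ                     ≡⟨ ≡.cong ⟦_⟧ℤ (ℤₚ.[1+m]⊖[1+n]≡m⊖n m n) ⟩
    ⟦ m ⊖ n ⟧ℤ                             ≈⟨ ⟦⟧-⊖ m n ⟩
    m ×′ 1# - n ×′ 1#                      ≈⟨ +-identityˡ _ ⟨
    0# + (m ×′ 1# - n ×′ 1#)               ≈⟨ +-congʳ (-‿inverseʳ 1#) ⟨
    1# - 1# + (m ×′ 1# - n ×′ 1#)          ≈⟨ interchange 1# (- 1#) (m ×′ 1#) (- (n ×′ 1#)) ⟩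
    (1# + m ×′ 1#) + (- 1# - n ×′ 1#)      ≈⟨ +-congˡ (-‿+-comm 1# (n ×′ 1#)) ⟩
    suc m ×′ 1# - suc n ×′ 1#              ∎
    where open import Algebra.Properties.CommutativeSemigroup +-commutativeSemigroup using (interchange)

  -1+‿homo : ∀ m n → - (suc (suc (m ℕ.+ n)) ×′ 1#) ≈ - (suc m ×′ 1#) - suc n ×′ 1#
  -1+‿homo m n = begin
    - (suc (suc (m ℕ.+ n)) ×′ 1#)          ≡⟨ ≡.cong (λ k → - (suc k ×′ 1#)) (ℕₚ.+-suc m n) ⟨
    - ((suc m ℕ.+ suc n) ×′ 1#)            ≈⟨ -‿cong (×-homo-+ 1# (suc m) (suc n)) ⟩
    - (suc m ×′ 1# + suc n ×′ 1#)          ≈⟨ -‿+-comm _ _ ⟨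
    - (suc m ×′ 1#) - suc n ×′ 1#          ∎

  ⟦⟧-+ : ∀ i j → ⟦ i ℤ.+ j ⟧ℤ ≈ ⟦ i ⟧ℤ + ⟦ j ⟧ℤ
  ⟦⟧-+ (+ m) (+ n)           = ×-homo-+ 1# m n
  ⟦⟧-+ (+ m) -[1+ n ]        = ⟦⟧-⊖ m (suc n)
  ⟦⟧-+ -[1+ m ] (+ n)        = trans (⟦⟧-⊖ n (suc m)) (+-comm _ _)
  ⟦⟧-+ -[1+ m ] -[1+ n ]     = -1+‿homo m n

  ⟦⟧-* : ∀ i j → ⟦ i ℤ.* j ⟧ℤ ≈ ⟦ i ⟧ℤ * ⟦ j ⟧ℤ
  ⟦⟧-* (+ zero) (+ n)        = sym (zeroˡ _)
  ⟦⟧-* (+ suc m) (+ zero)    = begin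
    ⟦ + suc m ℤ.* + zero ⟧ℤ  ≡⟨ ≡.cong ⟦_⟧ℤ (ℤₚ.*-zeroʳ (+ suc m)) ⟩
    0#                       ≈⟨ zeroʳ _ ⟨
    suc m ×′ 1# * 0#         ∎
  ⟦⟧-* (+ suc m) (+ suc n)   = ×1-homo-* (suc m) (suc n)
  ⟦⟧-* (+ zero) -[1+ n ]     = sym (zeroˡ _)
  ⟦⟧-* (+ suc m) -[1+ n ]    = trans (-‿cong (×1-homo-* (suc m) (suc n))) (-‿distribʳ-* _ _)
  ⟦⟧-* -[1+ m ] (+ zero)     = begin
    ⟦ -[1+ m ] ℤ.* + zero ⟧ℤ ≡⟨ ≡.cong ⟦_⟧ℤ (ℤₚ.*-zeroʳ -[1+ m ]) ⟩
    0#                       ≈⟨ zeroʳ _ ⟨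
    - (suc m ×′ 1#) * 0#     ∎
  ⟦⟧-* -[1+ m ] (+ suc n)    = trans (-‿cong (×1-homo-* (suc m) (suc n))) (-‿distribˡ-* _ _)
  ⟦⟧-* -[1+ m ] -[1+ n ]     = begin
    (suc m ℕ.* suc n) ×′ 1#              ≈⟨ ×1-homo-* (suc m) (suc n) ⟩
    suc m ×′ 1# * suc n ×′ 1#            ≈⟨ -‿involutive _ ⟨
    - - (suc m ×′ 1# * suc n ×′ 1#)      ≈⟨ -‿cong (-‿distribˡ-* _ _) ⟩
    - (- (suc m ×′ 1#) * suc n ×′ 1#)    ≈⟨ -‿distribʳ-* _ _ ⟩
    - (suc m ×′ 1#) * - (suc n ×′ 1#)    ∎

  ⟦⟧-neg : ∀ i → ⟦ ℤ.- i ⟧ℤ ≈ - ⟦ i ⟧ℤ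
  ⟦⟧-neg (+ zero)  = sym -0#≈0#
  ⟦⟧-neg (+ suc n) = refl
  ⟦⟧-neg -[1+ n ]  = sym (-‿involutive _)

  ℤ-morphism : ℤ.+-*-rawRing -Raw-AlmostCommutative⟶ fromCommutativeRing R
  ℤ-morphism = record
    { ⟦_⟧    = ⟦_⟧ℤ
    ; +-homo = ⟦⟧-+
    ; *-homo = ⟦⟧-*
    ; -‿homo = ⟦⟧-neg
    ; 0-homo = refl
    ; 1-homo = +-identityʳ 1#
    }

  -- `nothing` only means undecided: distinct integers can have equal images, as they do in positive
  -- characteristic.
  _coeff≟_ : ∀ i j → Maybe (⟦ i ⟧ℤ ≈ ⟦ j ⟧ℤ)
  i coeff≟ j with i ℤ.≟ j
  ... | yes i≡j = just (reflexive (≡.cong ⟦_⟧ℤ i≡j))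
  ... | no _    = nothing

  open import Algebra.Solver.Ring ℤ.+-*-rawRing (fromCommutativeRing R) ℤ-morphism _coeff≟_ public
    using (solve; con; _:=_; _:+_; _:*_; _:-_; :-_)

-- If `j` were missed, punching it out would turn `f` into an injection of `suc n` elements into
-- `n`.
injective⇒surjective : ∀ {n} {f : Fin n → Fin n} → Injective _≡_ _≡_ f → ∀ j → ∃[ i ] f i ≡ j
injective⇒surjective {suc n} {f} inj j with Finₚ.any? (λ i → f i Finₚ.≟ j)
... | yes hit  = hit
... | no  miss = contradiction
  (Finₚ.injective⇒≤ {f = λ i → punchOut (j≢f i)} (inj ∘ Finₚ.punchOut-injective (j≢f _) (j≢f _)))
  ℕₚ.1+n≰n
  where
  j≢f : ∀ i → ¬ j ≡ f i
  j≢f i j≡fi = miss (i , ≡.sym j≡fi)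

funToFin-cong : ∀ {m n} {f g : Fin m → Fin n} → (∀ i → f i ≡ g i) → funToFin f ≡ funToFin g
funToFin-cong {zero}  f≗g = ≡.refl
funToFin-cong {suc m} f≗g = ≡.cong₂ combine (f≗g zero) (funToFin-cong (f≗g ∘ suc))

prime∣^⇒∣ : ∀ {p} m k → Prime p → p ∣ m ^ k → p ∣ m
prime∣^⇒∣ {p} m zero pr p∣1 = contradiction (≡.subst Prime (∣1⇒≡1 p∣1) pr) ¬prime[1]
prime∣^⇒∣ m (suc k) pr p∣mm^k = [ (λ p∣m → p∣m) , prime∣^⇒∣ m k pr ]′ (euclidsLemma m (m ^ k) pr p∣mm^k)

even-prime-power : ∀ {p} k → Prime p → 2 ∣ p ^ k → p ≡ 2
even-prime-power {p} k pr 2∣p^k with prime⇒irreducible pr (prime∣^⇒∣ p k prime[2] 2∣p^k)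
... | inj₁ ()
... | inj₂ 2≡p = ≡.sym 2≡p

-- Finite fields: decidable equality, characteristic, pigeonhole for vectors.

module FieldProperties {q : ℕ} (F : FiniteField q) where
  open FiniteField F
  open CommutativeRing commRing hiding (zero; Carrier; _≈_; _+_; _*_; -_; _-_; 0#; 1#) public
  open import Algebra.Properties.Ring ring using (-0#≈0#; x∙y⁻¹≈ε⇒x≈y) public
  open import Algebra.Properties.Monoid.Mult +-monoid using () renaming (_×_ to _×′_)
  open import Algebra.Properties.Semiring.Mult semiring using (×1-homo-*)
  open import Algebra.Properties.Semiring.Sum semiring using (sum; sum-permute; sum-cong-≋; ∑-distrib-+; sum-replicate)
  open import Relation.Binary.Reasoning.Setoid setoid

  x-y≈0⇒x≈y : ∀ {x y} → x - y ≈ 0# → x ≈ y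
  x-y≈0⇒x≈y = x∙y⁻¹≈ε⇒x≈y _ _

  x+y≈x′+y′⇒x-x′≈y′-y : ∀ {x y x′ y′} → x + y ≈ x′ + y′ → x - x′ ≈ y′ - y
  x+y≈x′+y′⇒x-x′≈y′-y {x} {y} {x′} {y′} eq = begin
    x - x′                ≈⟨ solve 3 (λ x y x′ → x :- x′ := x :+ y :- x′ :- y) refl x y x′ ⟩
    x + y - x′ - y        ≈⟨ +-congʳ (+-congʳ eq) ⟩
    x′ + y′ - x′ - y      ≈⟨ solve 3 (λ y x′ y′ → x′ :+ y′ :- x′ :- y := y′ :- y) refl y x′ y′ ⟩
    y′ - y                ∎
    where open IntegerSolver commRing using (solve; _:=_; _:+_; _:-_)

  index : Carrier → Fin q
  index x = proj₁ (enum-surj x)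

  enum-index : ∀ x → enum (index x) ≈ x
  enum-index x = proj₂ (enum-surj x)

  index-injective : ∀ {x y} → index x ≡ index y → x ≈ y
  index-injective {x} {y} eq = begin
    x              ≈⟨ enum-index x ⟨
    enum (index x) ≡⟨ ≡.cong enum eq ⟩
    enum (index y) ≈⟨ enum-index y ⟩
    y              ∎

  index-cong : ∀ {x y} → x ≈ y → index x ≡ index y
  index-cong x≈y = enum-inj _ _ (trans (enum-index _) (trans x≈y (sym (enum-index _))))

  infix 4 _≟_
  _≟_ : ∀ x y → Dec (x ≈ y)
  x ≟ y with index x Finₚ.≟ index y
  ... | yes eq = yes (index-injective eq)
  ... | no neq = no (neq ∘ index-cong)

  x*y≈0⇒y≈0 : ∀ {x y} → ¬ x ≈ 0# → x * y ≈ 0# → y ≈ 0#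
  x*y≈0⇒y≈0 {x} {y} x≉0 xy≈0 = let z , xz≈1 = inverse x x≉0 in begin
    y           ≈⟨ *-identityˡ y ⟨
    1# * y      ≈⟨ *-congʳ xz≈1 ⟨
    x * z * y   ≈⟨ *-congʳ (*-comm x z) ⟩
    z * x * y   ≈⟨ *-assoc z x y ⟩
    z * (x * y) ≈⟨ *-congˡ xy≈0 ⟩
    z * 0#      ≈⟨ zeroʳ z ⟩
    0#          ∎

  x*y≉0 : ∀ {x y} → ¬ x ≈ 0# → ¬ y ≈ 0# → ¬ x * y ≈ 0#
  x*y≉0 x≉0 y≉0 = y≉0 ∘ x*y≈0⇒y≈0 x≉0

  x*y≉0⇒x≉0 : ∀ {x y} → ¬ x * y ≈ 0# → ¬ x ≈ 0#
  x*y≉0⇒x≉0 xy≉0 x≈0 = xy≉0 (trans (*-congʳ x≈0) (zeroˡ _))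

  x*y≉0⇒y≉0 : ∀ {x y} → ¬ x * y ≈ 0# → ¬ y ≈ 0#
  x*y≉0⇒y≉0 xy≉0 y≈0 = xy≉0 (trans (*-congˡ y≈0) (zeroʳ _))

  x*x≈0⇒x≈0 : ∀ {x} → x * x ≈ 0# → x ≈ 0#
  x*x≈0⇒x≈0 {x} xx≈0 with x ≟ 0#
  ... | yes x≈0 = x≈0
  ... | no x≉0  = x*y≈0⇒y≈0 x≉0 xx≈0

  1≉0 : ¬ 1# ≈ 0#
  1≉0 = 0≉1 ∘ sym

  -1≉0 : ¬ - 1# ≈ 0#
  -1≉0 -1≈0 = 1≉0 (begin
    1#        ≈⟨ +-identityʳ 1# ⟨
    1# + 0#   ≈⟨ +-congˡ -1≈0 ⟨
    1# - 1#   ≈⟨ -‿inverseʳ 1# ⟩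
    0#        ∎)

  -- Translation by 1 permutes the field, so it leaves the sum of all elements unchanged.
  q×1≈0 : q ×′ 1# ≈ 0#
  q×1≈0 = begin
    q ×′ 1#                                ≈⟨ +-identityˡ _ ⟨
    0# + q ×′ 1#                           ≈⟨ +-congʳ (-‿inverseˡ (sum enum)) ⟨
    - sum enum + sum enum + q ×′ 1#        ≈⟨ +-assoc _ _ _ ⟩
    - sum enum + (sum enum + q ×′ 1#)      ≈⟨ +-congˡ translated ⟨
    - sum enum + sum enum                  ≈⟨ -‿inverseˡ (sum enum) ⟩
    0#                                     ∎
    where
    shift : Carrier → Fin q → Fin q
    shift c i = index (enum i + c)

    shift-inverse : ∀ {c d} → c + d ≈ 0# → ∀ i → shift d (shift c i) ≡ i
    shift-inverse {c} {d} c+d≈0 i = enum-inj _ _ (begin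
      enum (index (enum (index (enum i + c)) + d)) ≈⟨ enum-index _ ⟩
      enum (index (enum i + c)) + d                ≈⟨ +-congʳ (enum-index _) ⟩
      enum i + c + d                               ≈⟨ +-assoc _ _ _ ⟩
      enum i + (c + d)                             ≈⟨ +-congˡ c+d≈0 ⟩
      enum i + 0#                                  ≈⟨ +-identityʳ _ ⟩
      enum i                                       ∎)

    translation = permutation (shift 1#) (shift (- 1#))
      (shift-inverse (-‿inverseˡ 1#)) (shift-inverse (-‿inverseʳ 1#))

    translated : sum enum ≈ sum enum + q ×′ 1#
    translated = begin
      sum enum                          ≈⟨ sum-permute enum translation ⟩
      sum (enum ∘ shift 1#)             ≈⟨ sum-cong-≋ (λ i → enum-index (enum i + 1#)) ⟩
      sum (λ i → enum i + 1#)           ≈⟨ ∑-distrib-+ enum (λ _ → 1#) ⟩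
      sum enum + sum {q} (λ _ → 1#)     ≈⟨ +-congˡ (sum-replicate q) ⟩
      sum enum + q ×′ 1#                ∎

  -- Multiples of 1 multiply like integers and there are no zero divisors, so factors `m` can be
  -- peeled off one at a time. This brings q · 1 = 0 down to p · 1 = 0.
  m^k×1≈0⇒m×1≈0 : ∀ m k → (m ^ k) ×′ 1# ≈ 0# → m ×′ 1# ≈ 0#
  m^k×1≈0⇒m×1≈0 m zero    1≈0 = contradiction (trans (sym (+-identityʳ 1#)) 1≈0) 1≉0
  m^k×1≈0⇒m×1≈0 m (suc k) eq with m ×′ 1# ≟ 0#
  ... | yes m×1≈0 = m×1≈0
  ... | no m×1≉0  = m^k×1≈0⇒m×1≈0 m k
    (x*y≈0⇒y≈0 m×1≉0 (trans (sym (×1-homo-* m (m ^ k))) eq))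

  Doubling≈0 : Set
  Doubling≈0 = ∀ x → x + x ≈ 0#

  even-order⇒x+x≈0 : ∀ {p} k → Prime p → q ≡ p ^ k → 2 ∣ q → Doubling≈0
  even-order⇒x+x≈0 {p} k pr q≡p^k 2∣q x = begin
    x + x               ≈⟨ +-cong (*-identityʳ x) (*-identityʳ x) ⟨
    x * 1# + x * 1#     ≈⟨ distribˡ x 1# 1# ⟨
    x * (1# + 1#)       ≈⟨ *-congˡ (+-congˡ (+-identityʳ 1#)) ⟨
    x * (2 ×′ 1#)       ≈⟨ *-congˡ (≡.subst (λ m → m ×′ 1# ≈ 0#) p≡2 p×1≈0) ⟩
    x * 0#              ≈⟨ zeroʳ x ⟩
    0#                  ∎
    where
    p≡2 : p ≡ 2
    p≡2 = even-prime-power k pr (≡.subst (2 ∣_) q≡p^k 2∣q)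

    p×1≈0 : p ×′ 1# ≈ 0#
    p×1≈0 = m^k×1≈0⇒m×1≈0 p k (≡.subst (λ m → m ×′ 1# ≈ 0#) q≡p^k q×1≈0)

  open Geometry F

  abstract
    -- Vectors are functions with a pointwise equality, so the pigeonhole principle is applied to
    -- their codes in `Fin (q ^ n)`.
    ≈ᵥ-injective⇒surjective : ∀ {n} (f : Vect n → Vect n) → (∀ {u v} → f u ≈ᵥ f v → u ≈ᵥ v) →
      ∀ v → ∃[ u ] f u ≈ᵥ v
    ≈ᵥ-injective⇒surjective {n} f f-inj v =
      let i , eq = injective⇒surjective inj (encode v) in decode i , encode-injective eq
      where
      encode : Vect n → Fin (q ^ n)
      encode w = funToFin (index ∘ w)

      decode : Fin (q ^ n) → Vect n
      decode i = enum ∘ finToFun i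

      encode-injective : ∀ {u w} → encode u ≡ encode w → u ≈ᵥ w
      encode-injective {u} {w} eq j = index-injective
        (≡.trans (≡.sym (Finₚ.finToFun-funToFin (index ∘ u) j))
          (≡.trans (≡.cong (λ i → finToFun i j) eq) (Finₚ.finToFun-funToFin (index ∘ w) j)))

      decode-injective : ∀ {i j} → decode i ≈ᵥ decode j → i ≡ j
      decode-injective {i} {j} eq = ≡.trans (≡.sym (Finₚ.funToFin-finToFin {n} {q} i))
        (≡.trans (funToFin-cong (λ k → enum-inj _ _ (eq k))) (Finₚ.funToFin-finToFin {n} {q} j))

      inj : Injective _≡_ _≡_ (encode ∘ f ∘ decode)
      inj eq = decode-injective (f-inj (encode-injective eq))

  nonZero? : ∀ {n} (v : Vect n) → NonZero v ⊎ v ≈ᵥ 0ᵥ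
  nonZero? v with Finₚ.any? (λ i → ¬? (v i ≟ 0#))
  ... | yes v≉0 = inj₁ v≉0
  ... | no v≈0  = inj₂ λ i → decidable-stable (v i ≟ 0#) (λ vi≉0 → v≈0 (i , vi≉0))

-- Linear maps, proportionality of vectors and induction over spans.

module LinearMaps {q : ℕ} (F : FiniteField q) where
  open FiniteField F
  open Geometry F
  open FieldProperties F
  open IntegerSolver commRing using (solve; _:=_; _:*_)
  open import Algebra.Properties.Ring ring using (-1*x≈-x)
  open import Algebra.Properties.Semiring.Sum semiring using (sum; sum-cong-≋; ∑-distrib-+; *-distribˡ-sum)
  open import Relation.Binary.Reasoning.Setoid setoid

  module _ (A : Matrix) where

    apply-cong : ∀ {u v} → u ≈ᵥ v → apply A u ≈ᵥ apply A v
    apply-cong u≈v i = sum-cong-≋ (λ j → *-congˡ {A i j} (u≈v j))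

    apply-+ : ∀ u v i → apply A (λ j → u j + v j) i ≈ apply A u i + apply A v i
    apply-+ u v i = trans (sum-cong-≋ (λ j → distribˡ (A i j) (u j) (v j)))
      (∑-distrib-+ (λ j → A i j * u j) (λ j → A i j * v j))

    apply-* : ∀ c u i → apply A (λ j → c * u j) i ≈ c * apply A u i
    apply-* c u i = sym (trans (*-distribˡ-sum c (λ j → A i j * u j))
      (sum-cong-≋ (λ j → solve 3 (λ c a x → c :* (a :* x) := a :* (c :* x)) refl c (A i j) (u j))))

    apply-- : ∀ u v i → apply A (λ j → u j - v j) i ≈ apply A u i - apply A v i
    apply-- u v i = begin
      apply A (λ j → u j - v j) i              ≈⟨ apply-cong (λ j → +-congˡ {u j} (sym (-1*x≈-x (v j)))) i ⟩
      apply A (λ j → u j + - 1# * v j) i       ≈⟨ apply-+ u (λ j → - 1# * v j) i ⟩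
      apply A u i + apply A (λ j → - 1# * v j) i ≈⟨ +-congˡ (trans (apply-* (- 1#) v i) (-1*x≈-x _)) ⟩
      apply A u i - apply A v i                ∎

    apply-0 : ∀ {u} → u ≈ᵥ 0ᵥ → apply A u ≈ᵥ 0ᵥ
    apply-0 {u} u≈0 i = begin
      apply A u i                   ≈⟨ apply-cong (λ j → trans (u≈0 j) (sym (zeroˡ 0#))) i ⟩
      apply A (λ _ → 0# * 0#) i     ≈⟨ apply-* 0# 0ᵥ i ⟩
      0# * apply A 0ᵥ i             ≈⟨ zeroˡ _ ⟩
      0#                            ∎

    apply-comb : ∀ a b c u v w i → apply A (λ j → a * u j + b * v j + c * w j) i ≈
      a * apply A u i + b * apply A v i + c * apply A w i
    apply-comb a b c u v w i = begin
      apply A (λ j → a * u j + b * v j + c * w j) i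
        ≈⟨ apply-+ (λ j → a * u j + b * v j) (λ j → c * w j) i ⟩
      apply A (λ j → a * u j + b * v j) i + apply A (λ j → c * w j) i
        ≈⟨ +-cong (apply-+ (λ j → a * u j) (λ j → b * v j) i) (apply-* c w i) ⟩
      apply A (λ j → a * u j) i + apply A (λ j → b * v j) i + c * apply A w i
        ≈⟨ +-congʳ (+-cong (apply-* a u i) (apply-* b v i)) ⟩
      a * apply A u i + b * apply A v i + c * apply A w i ∎

    apply-nonZero⁻ : ∀ {u} → NonZero (apply A u) → NonZero u
    apply-nonZero⁻ {u} (i , Aui≉0) with nonZero? u
    ... | inj₁ u≉0 = u≉0
    ... | inj₂ u≈0 = contradiction (apply-0 u≈0 i) Aui≉0

    module _ (A-inj : Nonsingular A) where

      apply-injective : ∀ {u v} → apply A u ≈ᵥ apply A v → u ≈ᵥ v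
      apply-injective {u} {v} eq j = x-y≈0⇒x≈y (A-inj (λ k → u k - v k)
        (λ i → trans (apply-- u v i) (trans (+-congʳ (eq i)) (-‿inverseʳ _))) j)

      apply-nonZero : ∀ {u} → NonZero u → NonZero (apply A u)
      apply-nonZero {u} (i , ui≉0) with nonZero? (apply A u)
      ... | inj₁ Au≉0 = Au≉0
      ... | inj₂ Au≈0 = contradiction (A-inj u Au≈0 i) ui≉0

  samePoint-sym : ∀ {n} {u v : Vect n} → SamePoint u v → SamePoint v u
  samePoint-sym {u = u} {v} (c , c≉0 , u≈cv) with inverse c c≉0
  ... | d , cd≈1 = d , x*y≉0⇒y≉0 (λ cd≈0 → 1≉0 (trans (sym cd≈1) cd≈0)) , λ i → begin
    v i            ≈⟨ *-identityˡ _ ⟨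
    1# * v i       ≈⟨ *-congʳ cd≈1 ⟨
    c * d * v i    ≈⟨ solve 3 (λ c d x → c :* d :* x := d :* (c :* x)) refl c d (v i) ⟩
    d * (c * v i)  ≈⟨ *-congˡ (u≈cv i) ⟨
    d * u i        ∎

  -- The minors force `v` to be nonzero wherever `u` is; at such a coordinate `r` the factor is
  -- `u r / v r`.
  minors≈0⇒samePoint : ∀ {n} {u v : Vect n} → NonZero u → NonZero v →
    (∀ r s → u r * v s - u s * v r ≈ 0#) → SamePoint u v
  minors≈0⇒samePoint {u = u} {v} (r , ur≉0) (t , vt≉0) minors = c , c≉0 , u≈cv
    where
    vr≉0 : ¬ v r ≈ 0#
    vr≉0 vr≈0 = x*y≉0 ur≉0 vt≉0 (begin
      u r * v t   ≈⟨ x-y≈0⇒x≈y (minors r t) ⟩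
      u t * v r   ≈⟨ *-congˡ vr≈0 ⟩
      u t * 0#    ≈⟨ zeroʳ _ ⟩
      0#          ∎)
    d = proj₁ (inverse (v r) vr≉0)
    vr*d≈1 = proj₂ (inverse (v r) vr≉0)
    c = u r * d
    c≉0 : ¬ c ≈ 0#
    c≉0 = x*y≉0 ur≉0 (x*y≉0⇒y≉0 (λ eq → 1≉0 (trans (sym vr*d≈1) eq)))
    u≈cv : ∀ s → u s ≈ c * v s
    u≈cv s = begin
      u s              ≈⟨ *-identityʳ _ ⟨
      u s * 1#         ≈⟨ *-congˡ vr*d≈1 ⟨
      u s * (v r * d)  ≈⟨ *-assoc _ _ _ ⟨
      u s * v r * d    ≈⟨ *-congʳ (x-y≈0⇒x≈y (minors r s)) ⟨
      u r * v s * d    ≈⟨ solve 3 (λ x y d → x :* y :* d := x :* d :* y) refl (u r) (v s) d ⟩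
      c * v s          ∎

  -- The closure conditions range over every `p` pointwise equal to the combination, because `P` is
  -- not assumed to respect `≈ᵥ`.
  span-induction : ∀ {S : PointSet} (P : PointSet) →
    (∀ {p} → p ≈ᵥ 0ᵥ → P p) →
    (∀ {p u v} c → P u → P v → (∀ i → p i ≈ c * u i + v i) → P p) →
    (∀ {p} → NonZero p → S p → P p) →
    ∀ {p} → Span S p → P p
  span-induction {S} P P-0 P-+ S⊆P {p} (_ , k , pts , coef , pts∈S , p≈) = go k p pts coef pts∈S p≈
    where
    -- Here `p` need not be nonzero: the partial sums met in the recursion may vanish.
    go : ∀ k p (pts : Fin k → Vect 6) (coef : Fin k → Carrier) → (∀ j → NonZero (pts j) × S (pts j)) →
      (∀ i → p i ≈ Σ[ (λ j → coef j * pts j i) ]) → P p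
    go zero    p pts coef pts∈S p≈ = P-0 p≈
    go (suc k) p pts coef pts∈S p≈ = P-+ (coef zero) (S⊆P (proj₁ (pts∈S zero)) (proj₂ (pts∈S zero)))
      (go k (λ i → Σ[ (λ j → coef (suc j) * pts (suc j) i) ]) (pts ∘ suc) (coef ∘ suc) (pts∈S ∘ suc) (λ _ → refl))
      p≈

-- The cone over the standard Veronese surface.

module Cones {q : ℕ} (F : FiniteField q) where
  open FiniteField F
  open Geometry F
  open FieldProperties F
  open LinearMaps F
  open IntegerSolver commRing using (solve; con; _:=_; _:+_; _:*_; _:-_; :-_)
  open import Relation.Binary.Reasoning.Setoid setoid

  -- Position of a coordinate in the symmetric matrix; `entry` leads back. They let the six clauses
  -- of `ν` be handled by one formula.
  row col : Fin 6 → Fin 3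
  row 0F = 0F
  row 1F = 1F
  row 2F = 2F
  row 3F = 0F
  row 4F = 0F
  row 5F = 1F
  col 0F = 0F
  col 1F = 1F
  col 2F = 2F
  col 3F = 1F
  col 4F = 2F
  col 5F = 2F

  entry : Fin 3 → Fin 3 → Fin 6
  entry 0F 0F = 0F
  entry 0F 1F = 3F
  entry 0F 2F = 4F
  entry 1F 0F = 3F
  entry 1F 1F = 1F
  entry 1F 2F = 5F
  entry 2F 0F = 4F
  entry 2F 1F = 5F
  entry 2F 2F = 2F

  ν-row-col : ∀ x i → ν x i ≡ x (row i) * x (col i)
  ν-row-col x 0F = ≡.refl
  ν-row-col x 1F = ≡.refl
  ν-row-col x 2F = ≡.refl
  ν-row-col x 3F = ≡.refl
  ν-row-col x 4F = ≡.refl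
  ν-row-col x 5F = ≡.refl

  ν-entry : ∀ x r s → ν x (entry r s) ≈ x r * x s
  ν-entry x 0F 0F = refl
  ν-entry x 0F 1F = refl
  ν-entry x 0F 2F = refl
  ν-entry x 1F 0F = *-comm _ _
  ν-entry x 1F 1F = refl
  ν-entry x 1F 2F = refl
  ν-entry x 2F 0F = *-comm _ _
  ν-entry x 2F 1F = *-comm _ _
  ν-entry x 2F 2F = refl

  ν-nonZero : ∀ {x} → NonZero x → NonZero (ν x)
  ν-nonZero {x} (r , xr≉0) = entry r r , λ eq → x*y≉0 xr≉0 xr≉0 (trans (sym (ν-entry x r r)) eq)

  -- Both `c` and `x` may be zero, which makes this set closed under all scalars.
  Cone : Vect 6 → Set
  Cone u = ∃[ c ] ∃[ x ] (∀ i → u i ≈ c * ν x i)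

  cone-0 : Cone 0ᵥ
  cone-0 = 0# , 0ᵥ , λ i → sym (zeroˡ _)

  cone-* : ∀ {u} c → Cone u → Cone (λ i → c * u i)
  cone-* c (d , x , u≈) = c * d , x , λ i → trans (*-congˡ (u≈ i)) (sym (*-assoc _ _ _))

  detSym-cong : ∀ {u v} → u ≈ᵥ v → detSym u ≈ detSym v
  detSym-cong u≈v = +-cong
    (+-cong (*-cong (u≈v 0F) (+-cong (*-cong (u≈v 1F) (u≈v 2F)) (-‿cong (*-cong (u≈v 5F) (u≈v 5F)))))
      (-‿cong (*-cong (u≈v 3F) (+-cong (*-cong (u≈v 3F) (u≈v 2F)) (-‿cong (*-cong (u≈v 5F) (u≈v 4F)))))))
    (*-cong (u≈v 4F) (+-cong (*-cong (u≈v 3F) (u≈v 5F)) (-‿cong (*-cong (u≈v 1F) (u≈v 4F)))))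

  -- A polynomial identity with integer coefficients, hence valid in every characteristic;
  -- `m x x′ y y′` stands for an entry of c x xᵀ - d y yᵀ.
  detSym-difference : ∀ {u v} → Cone u → Cone v → detSym (λ i → u i - v i) ≈ 0#
  detSym-difference (c , x , u≈) (d , y , v≈) =
    trans (detSym-cong (λ i → +-cong (u≈ i) (-‿cong (v≈ i))))
      (solve 8 (λ c d x₀ x₁ x₂ y₀ y₁ y₂ →
        let m = λ x x′ y y′ → c :* (x :* x′) :- d :* (y :* y′)
            m₀₀ = m x₀ x₀ y₀ y₀
            m₁₁ = m x₁ x₁ y₁ y₁
            m₂₂ = m x₂ x₂ y₂ y₂
            m₀₁ = m x₀ x₁ y₀ y₁
            m₀₂ = m x₀ x₂ y₀ y₂
            m₁₂ = m x₁ x₂ y₁ y₂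
        in m₀₀ :* (m₁₁ :* m₂₂ :- m₁₂ :* m₁₂) :- m₀₁ :* (m₀₁ :* m₂₂ :- m₁₂ :* m₀₂)
             :+ m₀₂ :* (m₀₁ :* m₁₂ :- m₁₁ :* m₀₂) := con (+ 0))
        refl c d (x 0F) (x 1F) (x 2F) (y 0F) (y 1F) (y 2F))

  -- The 2×2 minors of x xᵀ vanish, while those of b y yᵀ + c z zᵀ are b c times products of minors of (y, z).
  cone-sum≈0⇒samePoint : ∀ {u v w} → Cone u → Cone v → Cone w → NonZero v → NonZero w →
    (∀ i → u i + v i + w i ≈ 0#) → SamePoint v w
  cone-sum≈0⇒samePoint {u} {v} {w} (a , x , u≈) (b , y , v≈) (c , z , w≈) (i , vi≉0) (j , wj≉0) sum≈0 =
    samePoint (minors≈0⇒samePoint y≉0 z≉0 minors)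
    where
    byi≉0 : ¬ b * ν y i ≈ 0#
    byi≉0 eq = vi≉0 (trans (v≈ i) eq)
    czj≉0 : ¬ c * ν z j ≈ 0#
    czj≉0 eq = wj≉0 (trans (w≈ j) eq)
    b≉0 = x*y≉0⇒x≉0 byi≉0
    c≉0 = x*y≉0⇒x≉0 czj≉0

    y≉0 : NonZero y
    y≉0 = row i , x*y≉0⇒x≉0 (≡.subst (λ t → ¬ t ≈ 0#) (ν-row-col y i) (x*y≉0⇒y≉0 byi≉0))
    z≉0 : NonZero z
    z≉0 = row j , x*y≉0⇒x≉0 (≡.subst (λ t → ¬ t ≈ 0#) (ν-row-col z j) (x*y≉0⇒y≉0 czj≉0))

    X S : Fin 3 → Fin 3 → Carrier
    X r s = a * (x r * x s)
    S r s = b * (y r * y s) + c * (z r * z s)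

    S≈-X : ∀ r s → S r s ≈ - X r s
    S≈-X r s = x-y≈0⇒x≈y (begin
      S r s - - X r s
        ≈⟨ solve 3 (λ p q t → q :+ t :- :- p := p :+ q :+ t) refl (X r s) (b * (y r * y s)) (c * (z r * z s)) ⟩
      X r s + b * (y r * y s) + c * (z r * z s)
        ≈⟨ +-cong (+-cong (at a x u≈) (at b y v≈)) (at c z w≈) ⟩
      u (entry r s) + v (entry r s) + w (entry r s)
        ≈⟨ sum≈0 (entry r s) ⟩
      0# ∎)
      where
      at : ∀ {p : Vect 6} k t → (∀ i → p i ≈ k * ν t i) → k * (t r * t s) ≈ p (entry r s)
      at k t p≈ = trans (*-congˡ (sym (ν-entry t r s))) (sym (p≈ (entry r s)))

    minors : ∀ r s → y r * z s - y s * z r ≈ 0#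
    minors r s = x*x≈0⇒x≈0 (x*y≈0⇒y≈0 (x*y≉0 b≉0 c≉0) (begin
      b * c * ((y r * z s - y s * z r) * (y r * z s - y s * z r))
        ≈⟨ solve 6 (λ b c yr ys zr zs →
             let d = λ y y′ z z′ → b :* (y :* y′) :+ c :* (z :* z′)
             in b :* c :* ((yr :* zs :- ys :* zr) :* (yr :* zs :- ys :* zr)) :=
                d yr yr zr zr :* d ys ys zs zs :- d yr ys zr zs :* d yr ys zr zs)
             refl b c (y r) (y s) (z r) (z s) ⟩
      S r r * S s s - S r s * S r s
        ≈⟨ +-cong (*-cong (S≈-X r r) (S≈-X s s)) (-‿cong (*-cong (S≈-X r s) (S≈-X r s))) ⟩
      - X r r * - X s s - - X r s * - X r s
        ≈⟨ solve 3 (λ a p q → :- (a :* (p :* p)) :* :- (a :* (q :* q))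
               :- :- (a :* (p :* q)) :* :- (a :* (p :* q)) := con (+ 0)) refl a (x r) (x s) ⟩
      0# ∎))

    samePoint : SamePoint y z → SamePoint v w
    samePoint (e , e≉0 , y≈ez) with inverse c c≉0
    ... | d , cd≈1 =
      -- With `d` inverse to `c`: v = b ν(y) = b e² ν(z) = (b e² d) w.
      b * (d * (e * e)) ,
      x*y≉0 b≉0 (x*y≉0 (x*y≉0⇒y≉0 (λ eq → 1≉0 (trans (sym cd≈1) eq))) (x*y≉0 e≉0 e≉0)) , λ k → begin
      v k                                  ≈⟨ v≈ k ⟩
      b * ν y k                            ≡⟨ ≡.cong (b *_) (ν-row-col y k) ⟩
      b * (y (row k) * y (col k))          ≈⟨ *-congˡ (*-cong (y≈ez (row k)) (y≈ez (col k))) ⟩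
      b * (e * z (row k) * (e * z (col k)))
        ≈⟨ solve 4 (λ b e p q → b :* (e :* p :* (e :* q)) := b :* (e :* e :* (p :* q)))
             refl b e (z (row k)) (z (col k)) ⟩
      b * (e * e * (z (row k) * z (col k)))  ≈⟨ *-congˡ (*-identityˡ _) ⟨
      b * (1# * (e * e * (z (row k) * z (col k)))) ≈⟨ *-congˡ (*-congʳ cd≈1) ⟨
      b * (c * d * (e * e * (z (row k) * z (col k))))
        ≈⟨ solve 5 (λ b c d e p → b :* (c :* d :* (e :* e :* p)) := b :* (d :* (e :* e)) :* (c :* p))
             refl b c d e (z (row k) * z (col k)) ⟩
      b * (d * (e * e)) * (c * (z (row k) * z (col k))) ≡⟨ ≡.cong (λ t → b * (d * (e * e)) * (c * t)) (ν-row-col z k) ⟨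
      b * (d * (e * e)) * (c * ν z k)      ≈⟨ *-congˡ (w≈ k) ⟨
      b * (d * (e * e)) * w k              ∎

  SameDiagonal : Vect 6 → Vect 6 → Set
  SameDiagonal u v = ∀ r → u (entry r r) ≈ v (entry r r)

  -- The last coordinate is the default value, so `lead v` vanishes exactly when `v` does.
  lead : Vect 3 → Carrier
  lead v with v 0F ≟ 0# | v 1F ≟ 0#
  ... | no _  | _     = v 0F
  ... | yes _ | no _  = v 1F
  ... | yes _ | yes _ = v 2F

  recip : Carrier → Carrier
  recip x with x ≟ 0#
  ... | yes _   = 0#
  ... | no x≉0  = proj₁ (inverse x x≉0)

  -- The hypothesis accommodates the zero vector: its `lead` is 0, `recip` returns 0 there, and the
  -- cancellation still holds because `y` is 0 as well.
  recip-* : ∀ x y → (x ≈ 0# → y ≈ 0#) → recip x * (x * y) ≈ y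
  recip-* x y x≈0⇒y≈0 with x ≟ 0#
  ... | yes x≈0 = trans (zeroˡ _) (sym (x≈0⇒y≈0 x≈0))
  ... | no x≉0  = let z , xz≈1 = inverse x x≉0 in begin
    z * (x * y)  ≈⟨ solve 3 (λ x y z → z :* (x :* y) := x :* z :* y) refl x y z ⟩
    x * z * y    ≈⟨ *-congʳ xz≈1 ⟩
    1# * y       ≈⟨ *-identityˡ y ⟩
    y            ∎

  -- A bijection of F³ with the cone: when v is nonzero, the row of the symmetric
  -- matrix φ v at the first nonzero coordinate of v is v itself.
  φ : Vect 3 → Vect 6
  φ v i = recip (lead v) * ν v i

  φ-cone : ∀ v → Cone (φ v)
  φ-cone v = recip (lead v) , v , λ _ → refl

  -- Besides the row of `u` that equals `v`, each constructor records enough of the diagonal of `u`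
  -- to be told apart from the others; `row₂` includes v = 0.
  data LeadingRow (v : Vect 3) (u : Vect 6) : Set where
    row₀ : ¬ v 0F ≈ 0# → u 0F ≈ v 0F → u 3F ≈ v 1F → u 4F ≈ v 2F → LeadingRow v u
    row₁ : v 0F ≈ 0# → ¬ v 1F ≈ 0# → u 0F ≈ 0# → u 1F ≈ v 1F → u 5F ≈ v 2F → LeadingRow v u
    row₂ : v 0F ≈ 0# → v 1F ≈ 0# → u 0F ≈ 0# → u 1F ≈ 0# → u 2F ≈ v 2F → LeadingRow v u

  φ-leadingRow : ∀ v → LeadingRow v (φ v)
  φ-leadingRow v with v 0F ≟ 0# | v 1F ≟ 0#
  ... | no v₀≉0 | _ = row₀ v₀≉0 (row≈ (v 0F)) (row≈ (v 1F)) (row≈ (v 2F))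
    where
    row≈ : ∀ y → recip (v 0F) * (v 0F * y) ≈ y
    row≈ y = recip-* _ y (λ v₀≈0 → contradiction v₀≈0 v₀≉0)
  ... | yes v₀≈0 | no v₁≉0 = row₁ v₀≈0 v₁≉0
    (trans (*-congˡ (trans (*-congʳ v₀≈0) (zeroˡ _))) (zeroʳ _)) (row≈ (v 1F)) (row≈ (v 2F))
    where
    row≈ : ∀ y → recip (v 1F) * (v 1F * y) ≈ y
    row≈ y = recip-* _ y (λ v₁≈0 → contradiction v₁≈0 v₁≉0)
  ... | yes v₀≈0 | yes v₁≈0 = row₂ v₀≈0 v₁≈0
    (trans (*-congˡ (trans (*-congʳ v₀≈0) (zeroˡ _))) (zeroʳ _))
    (trans (*-congˡ (trans (*-congʳ v₁≈0) (zeroˡ _))) (zeroʳ _))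
    (recip-* _ _ (λ v₂≈0 → v₂≈0))

  leadingRow-injective : ∀ {v v′ u u′} → LeadingRow v u → LeadingRow v′ u′ → u ≈ᵥ u′ → v ≈ᵥ v′
  leadingRow-injective (row₀ _ e₀ e₁ e₂) (row₀ _ e₀′ e₁′ e₂′) u≈u′ = λ where
    0F → trans (sym e₀) (trans (u≈u′ 0F) e₀′)
    1F → trans (sym e₁) (trans (u≈u′ 3F) e₁′)
    2F → trans (sym e₂) (trans (u≈u′ 4F) e₂′)
  leadingRow-injective (row₁ z₀ _ _ e₁ e₂) (row₁ z₀′ _ _ e₁′ e₂′) u≈u′ = λ where
    0F → trans z₀ (sym z₀′)
    1F → trans (sym e₁) (trans (u≈u′ 1F) e₁′)
    2F → trans (sym e₂) (trans (u≈u′ 5F) e₂′)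
  leadingRow-injective (row₂ z₀ z₁ _ _ e₂) (row₂ z₀′ z₁′ _ _ e₂′) u≈u′ = λ where
    0F → trans z₀ (sym z₀′)
    1F → trans z₁ (sym z₁′)
    2F → trans (sym e₂) (trans (u≈u′ 2F) e₂′)
  leadingRow-injective (row₀ v₀≉0 e₀ _ _) (row₁ _ _ u₀≈0 _ _) u≈u′ =
    contradiction (trans (sym e₀) (trans (u≈u′ 0F) u₀≈0)) v₀≉0
  leadingRow-injective (row₀ v₀≉0 e₀ _ _) (row₂ _ _ u₀≈0 _ _) u≈u′ =
    contradiction (trans (sym e₀) (trans (u≈u′ 0F) u₀≈0)) v₀≉0
  leadingRow-injective (row₁ _ v₁≉0 _ e₁ _) (row₂ _ _ _ u₁≈0 _) u≈u′ =
    contradiction (trans (sym e₁) (trans (u≈u′ 1F) u₁≈0)) v₁≉0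
  leadingRow-injective r@(row₁ _ _ _ _ _) r′@(row₀ _ _ _ _) u≈u′ = sym ∘ leadingRow-injective r′ r (sym ∘ u≈u′)
  leadingRow-injective r@(row₂ _ _ _ _ _) r′@(row₀ _ _ _ _) u≈u′ = sym ∘ leadingRow-injective r′ r (sym ∘ u≈u′)
  leadingRow-injective r@(row₂ _ _ _ _ _) r′@(row₁ _ _ _ _ _) u≈u′ = sym ∘ leadingRow-injective r′ r (sym ∘ u≈u′)

  φ-injective : ∀ {v v′} → φ v ≈ᵥ φ v′ → v ≈ᵥ v′
  φ-injective {v} {v′} = leadingRow-injective (φ-leadingRow v) (φ-leadingRow v′)

-- Characteristic 2: diagonals, conics and the nuclear plane.

module Characteristic2 {q : ℕ} (F : FiniteField q) (x+x≈0 : FieldProperties.Doubling≈0 F) where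
  open FiniteField F
  open Geometry F
  open FieldProperties F
  open LinearMaps F
  open Cones F
  open IntegerSolver commRing using (solve; con; _:=_; _:+_; _:*_; _:-_; :-_)
  open import Relation.Binary.Reasoning.Setoid setoid

  [x-y]²≈x²+y² : ∀ x y → (x - y) * (x - y) ≈ x * x + y * y
  [x-y]²≈x²+y² x y = begin
    (x - y) * (x - y)
      ≈⟨ solve 2 (λ x y → (x :- y) :* (x :- y) := x :* x :+ y :* y :- (x :* y :+ x :* y)) refl x y ⟩
    x * x + y * y - (x * y + x * y)     ≈⟨ +-congˡ (-‿cong (x+x≈0 _)) ⟩
    x * x + y * y - 0#                  ≈⟨ trans (+-congˡ -0#≈0#) (+-identityʳ _) ⟩
    x * x + y * y                       ∎

  x²≈y²⇒x≈y : ∀ {x y} → x * x ≈ y * y → x ≈ y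
  x²≈y²⇒x≈y {x} {y} eq = x-y≈0⇒x≈y (x*x≈0⇒x≈0 (begin
    (x - y) * (x - y)   ≈⟨ [x-y]²≈x²+y² x y ⟩
    x * x + y * y       ≈⟨ +-congʳ eq ⟩
    y * y + y * y       ≈⟨ x+x≈0 _ ⟩
    0#                  ∎))

  -- Squaring is injective in characteristic 2, hence onto by finiteness; the field is viewed as
  -- `Vect 1`.
  square-root : ∀ x → ∃[ y ] y * y ≈ x
  square-root x =
    let u , eq = ≈ᵥ-injective⇒surjective {1} (λ v i → v i * v i) (λ eq i → x²≈y²⇒x≈y (eq i)) (λ _ → x)
    in u 0F , eq 0F

  -- In a matrix c x xᵀ the square of the (r, s) entry is the product of the diagonal entries at r
  -- and s.
  cone-diagonal-injective : ∀ {u v} → Cone u → Cone v → SameDiagonal u v → u ≈ᵥ v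
  cone-diagonal-injective {u} {v} (c , x , u≈) (d , y , v≈) diag i = begin
    u i              ≈⟨ u≈ i ⟩
    c * ν x i        ≡⟨ ≡.cong (c *_) (ν-row-col x i) ⟩
    c * (x r * x s)  ≈⟨ x²≈y²⇒x≈y (begin
      c * (x r * x s) * (c * (x r * x s))    ≈⟨ rearrange c x ⟩
      c * (x r * x r) * (c * (x s * x s))    ≈⟨ *-cong (diag′ r) (diag′ s) ⟩
      d * (y r * y r) * (d * (y s * y s))    ≈⟨ rearrange d y ⟨
      d * (y r * y s) * (d * (y r * y s))    ∎) ⟩
    d * (y r * y s)  ≡⟨ ≡.cong (d *_) (ν-row-col y i) ⟨
    d * ν y i        ≈⟨ v≈ i ⟨
    v i              ∎
    where
    r = row i
    s = col i
    rearrange : ∀ k (t : Vect 3) → k * (t r * t s) * (k * (t r * t s)) ≈ k * (t r * t r) * (k * (t s * t s))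
    rearrange k t = solve 3 (λ k p q → k :* (p :* q) :* (k :* (p :* q)) := k :* (p :* p) :* (k :* (q :* q)))
      refl k (t r) (t s)
    diag′ : ∀ j → c * (x j * x j) ≈ d * (y j * y j)
    diag′ j = begin
      c * (x j * x j)        ≈⟨ *-congˡ (ν-entry x j j) ⟨
      c * ν x (entry j j)    ≈⟨ u≈ _ ⟨
      u (entry j j)          ≈⟨ diag j ⟩
      v (entry j j)          ≈⟨ v≈ _ ⟩
      d * ν y (entry j j)    ≈⟨ *-congˡ (ν-entry y j j) ⟩
      d * (y j * y j)        ∎

  -- The matrix u wᵀ + w uᵀ, the polarisation of `ν`. For independent `u` and `w` it represents the
  -- nucleus of the conic over the line joining them.
  polar : Vect 3 → Vect 3 → Vect 6
  polar u w i = u (row i) * w (col i) + u (col i) * w (row i)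

  -- By `ν-pencil`, the conic has the equation α γ = δ² in these coordinates.
  conicPlane : Carrier → Carrier → Carrier → Vect 3 → Vect 3 → Vect 6
  conicPlane α γ δ u w i = α * ν u i + γ * ν w i + δ * polar u w i

  polar-diagonal : ∀ u w r → polar u w (entry r r) ≈ 0#
  polar-diagonal u w 0F = x+x≈0 _
  polar-diagonal u w 1F = x+x≈0 _
  polar-diagonal u w 2F = x+x≈0 _

  conicPlane-cong : ∀ {α α′ γ δ δ′ u w} → α ≈ α′ → δ ≈ δ′ → conicPlane α γ δ u w ≈ᵥ conicPlane α′ γ δ′ u w
  conicPlane-cong {γ = γ} {u = u} {w} α≈α′ δ≈δ′ i =
    +-cong (+-congʳ {γ * ν w i} (*-congʳ {ν u i} α≈α′)) (*-congʳ {polar u w i} δ≈δ′)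

  ν-cong : ∀ {x y} → x ≈ᵥ y → ν x ≈ᵥ ν y
  ν-cong {x} {y} x≈y i = begin
    ν x i                  ≡⟨ ν-row-col x i ⟩
    x (row i) * x (col i)  ≈⟨ *-cong (x≈y (row i)) (x≈y (col i)) ⟩
    y (row i) * y (col i)  ≡⟨ ν-row-col y i ⟨
    ν y i                  ∎

  ν-pencil : ∀ s t u w i → ν (λ j → s * u j + t * w j) i ≈ conicPlane (s * s) (t * t) (s * t) u w i
  ν-pencil s t u w i = begin
    ν (λ j → s * u j + t * w j) i
      ≡⟨ ν-row-col (λ j → s * u j + t * w j) i ⟩
    (s * u (row i) + t * w (row i)) * (s * u (col i) + t * w (col i))
      ≈⟨ solve 6 (λ s t p q p′ q′ → (s :* p :+ t :* p′) :* (s :* q :+ t :* q′) :=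
           s :* s :* (p :* q) :+ t :* t :* (p′ :* q′) :+ s :* t :* (p :* q′ :+ q :* p′))
           refl s t (u (row i)) (u (col i)) (w (row i)) (w (col i)) ⟩
    s * s * (u (row i) * u (col i)) + t * t * (w (row i) * w (col i)) + s * t * polar u w i
      ≡⟨ ≡.cong₂ (λ p q → s * s * p + t * t * q + s * t * polar u w i) (ν-row-col u i) (ν-row-col w i) ⟨
    conicPlane (s * s) (t * t) (s * t) u w i ∎

  -- Adding a multiple of the second row leaves a minor unchanged, and scaling the first row by `a`
  -- multiplies it by `a`.
  pencil-minors≈0 : ∀ {a b} {u w : Vect 3} → ¬ a ≈ 0# →
    (∀ r s → (a * u r + b * w r) * w s - (a * u s + b * w s) * w r ≈ 0#) →
    ∀ r s → u r * w s - u s * w r ≈ 0#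
  pencil-minors≈0 {a} {b} {u} {w} a≉0 eq r s = x*y≈0⇒y≈0 a≉0 (trans
    (solve 6 (λ a b ur us wr ws → a :* (ur :* ws :- us :* wr) :=
       (a :* ur :+ b :* wr) :* ws :- (a :* us :+ b :* ws) :* wr) refl a b (u r) (u s) (w r) (w s))
    (eq r s))

  module _ (A : Matrix) (A-inj : Nonsingular A) where

    ConicPlane : Vect 3 → Vect 3 → PointSet
    ConicPlane u w p = ∃[ α ] ∃[ γ ] ∃[ δ ] (p ≈ᵥ apply A (conicPlane α γ δ u w))

    span-conic⊆conicPlane : ∀ {u w p} → Span (Conic A u w) p → ConicPlane u w p
    span-conic⊆conicPlane {u} {w} = span-induction (ConicPlane u w) zero-case add-case conic-case
      where
      zero-case : ∀ {p} → p ≈ᵥ 0ᵥ → ConicPlane u w p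
      zero-case p≈0 = 0# , 0# , 0# , λ i → trans (p≈0 i) (sym (apply-0 A {conicPlane 0# 0# 0# u w}
        (λ j → trans (+-cong (+-cong (zeroˡ _) (zeroˡ _)) (zeroˡ _)) (trans (+-identityʳ _) (+-identityʳ _))) i))

      add-case : ∀ {p p₁ p₂} c → ConicPlane u w p₁ → ConicPlane u w p₂ →
        (∀ i → p i ≈ c * p₁ i + p₂ i) → ConicPlane u w p
      add-case {p} {p₁} {p₂} c (α , γ , δ , p₁≈) (α′ , γ′ , δ′ , p₂≈) p≈ =
        c * α + α′ , c * γ + γ′ , c * δ + δ′ , λ i → begin
        p i              ≈⟨ p≈ i ⟩
        c * p₁ i + p₂ i  ≈⟨ +-cong (*-congˡ (p₁≈ i)) (p₂≈ i) ⟩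
        c * apply A (conicPlane α γ δ u w) i + apply A (conicPlane α′ γ′ δ′ u w) i
          ≈⟨ +-congʳ (apply-* A c (conicPlane α γ δ u w) i) ⟨
        apply A (λ j → c * conicPlane α γ δ u w j) i + apply A (conicPlane α′ γ′ δ′ u w) i
          ≈⟨ apply-+ A (λ j → c * conicPlane α γ δ u w j) (conicPlane α′ γ′ δ′ u w) i ⟨
        apply A (λ j → c * conicPlane α γ δ u w j + conicPlane α′ γ′ δ′ u w j) i
          ≈⟨ apply-cong A (λ j → combine-coefficients (ν u j) (ν w j) (polar u w j)) i ⟩
        apply A (conicPlane (c * α + α′) (c * γ + γ′) (c * δ + δ′) u w) i ∎
        where
        combine-coefficients : ∀ x y z → c * (α * x + γ * y + δ * z) + (α′ * x + γ′ * y + δ′ * z) ≈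
          (c * α + α′) * x + (c * γ + γ′) * y + (c * δ + δ′) * z
        combine-coefficients x y z = begin
          c * (α * x + γ * y + δ * z) + (α′ * x + γ′ * y + δ′ * z)
            ≈⟨ +-congʳ (solve 4 (λ c p q r → c :* (p :+ q :+ r) := c :* p :+ c :* q :+ c :* r)
                 refl c (α * x) (γ * y) (δ * z)) ⟩
          c * (α * x) + c * (γ * y) + c * (δ * z) + (α′ * x + γ′ * y + δ′ * z)
            ≈⟨ solve 6 (λ p q r p′ q′ r′ → p :+ q :+ r :+ (p′ :+ q′ :+ r′) := (p :+ p′) :+ (q :+ q′) :+ (r :+ r′))
                 refl (c * (α * x)) (c * (γ * y)) (c * (δ * z)) (α′ * x) (γ′ * y) (δ′ * z) ⟩
          (c * (α * x) + α′ * x) + (c * (γ * y) + γ′ * y) + (c * (δ * z) + δ′ * z)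
            ≈⟨ +-cong (+-cong (collect α α′ x) (collect γ γ′ y)) (collect δ δ′ z) ⟩
          (c * α + α′) * x + (c * γ + γ′) * y + (c * δ + δ′) * z ∎
          where
          collect : ∀ β β′ t → c * (β * t) + β′ * t ≈ (c * β + β′) * t
          collect β β′ t = solve 4 (λ c β β′ t → c :* (β :* t) :+ β′ :* t := (c :* β :+ β′) :* t) refl c β β′ t

      conic-case : ∀ {p} → NonZero p → Conic A u w p → ConicPlane u w p
      conic-case {p} _ (s , t , _ , c , _ , p≈) =
        add-case {p₁ = apply A (ν (λ j → s * u j + t * w j))} {p₂ = 0ᵥ} c
        (s * s , t * t , s * t , apply-cong A (ν-pencil s t u w)) (zero-case (λ _ → refl))
        (λ i → trans (p≈ i) (sym (+-identityʳ _)))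

    Tangential : PointSet → Vect 6 → Set
    Tangential C N = ∀ P P′ → NonZero P′ → C P → C P′ → Collinear N P P′ → SamePoint P P′

    -- In the coordinates of the conic plane, N = (a², γ, ab) and ν(a u + b w) = (a², b², ab) differ
    -- by a multiple of ν(w). Tangency thus forces the conic points of a u + b w and w to coincide.
    tangential⇒parallel : ∀ {u w N γ} a b → ¬ a ≈ 0# → NonZero u → NonZero w →
      N ≈ᵥ apply A (conicPlane (a * a) γ (a * b) u w) → Tangential (Conic A u w) N → SamePoint u w
    tangential⇒parallel {u} {w} {N} {γ} a b a≉0 u≉0 w≉0 N≈ tangential with nonZero? (λ j → a * u j + b * w j)
    -- If a u + b w = 0 there is no second conic point, but this relation already makes `u` and `w`
    -- proportional.
    ... | inj₂ x≈0 = minors≈0⇒samePoint u≉0 w≉0 (pencil-minors≈0 a≉0 λ r s → begin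
      (a * u r + b * w r) * w s - (a * u s + b * w s) * w r
                              ≈⟨ +-cong (*-congʳ (x≈0 r)) (-‿cong (*-congʳ (x≈0 s))) ⟩
      0# * w s - 0# * w r     ≈⟨ +-cong (zeroˡ _) (-‿cong (zeroˡ _)) ⟩
      0# - 0#                 ≈⟨ -‿inverseʳ 0# ⟩
      0#                      ∎)
    ... | inj₁ x≉0 = minors≈0⇒samePoint u≉0 w≉0 minors
      where
      x : Vect 3
      x j = a * u j + b * w j

      P P′ : Vect 6
      P  = apply A (ν x)
      P′ = apply A (ν w)

      w≈0u+1w : w ≈ᵥ (λ j → 0# * u j + 1# * w j)
      w≈0u+1w j = sym (trans (+-cong (zeroˡ _) (*-identityˡ _)) (+-identityˡ _))

      P∈C : Conic A u w P
      P∈C = a , b , x≉0 , 1# , 1≉0 , λ i → sym (*-identityˡ _)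

      P′∈C : Conic A u w P′
      P′∈C = 0# , 1# , (proj₁ w≉0 , λ eq → proj₂ w≉0 (trans (w≈0u+1w _) eq)) , 1# , 1≉0 ,
        λ i → trans (apply-cong A (ν-cong w≈0u+1w) i) (sym (*-identityˡ _))

      collinear : Collinear N P P′
      -- The relation N - P + (b² - γ) P′ = 0 multiplied by `a`, whose nonvanishing is at hand.
      collinear = a , - a , a * (b * b - γ) , inj₁ a≉0 , λ i → begin
        a * N i + - a * P i + a * (b * b - γ) * P′ i
          ≈⟨ +-congʳ (+-congʳ (*-congˡ (N≈ i))) ⟩
        a * apply A (conicPlane (a * a) γ (a * b) u w) i + - a * P i + a * (b * b - γ) * P′ i
          ≈⟨ apply-comb A a (- a) (a * (b * b - γ)) (conicPlane (a * a) γ (a * b) u w) (ν x) (ν w) i ⟨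
        apply A (λ j → a * conicPlane (a * a) γ (a * b) u w j + - a * ν x j + a * (b * b - γ) * ν w j) i
          ≈⟨ apply-0 A vanishes i ⟩
        0# ∎
        where
        cancel : ∀ p q r → a * (p + γ * q + r) + - a * (p + b * b * q + r) + a * (b * b - γ) * q ≈ 0#
        cancel p q r = solve 6 (λ a β γ p q r →
          a :* (p :+ γ :* q :+ r) :+ :- a :* (p :+ β :* q :+ r) :+ a :* (β :- γ) :* q := con (+ 0))
          refl a (b * b) γ p q r

        vanishes : ∀ j → a * conicPlane (a * a) γ (a * b) u w j + - a * ν x j + a * (b * b - γ) * ν w j ≈ 0#
        vanishes j = begin
          a * conicPlane (a * a) γ (a * b) u w j + - a * ν x j + a * (b * b - γ) * ν w j
            ≈⟨ +-congʳ (+-congˡ (*-congˡ (ν-pencil a b u w j))) ⟩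
          a * conicPlane (a * a) γ (a * b) u w j + - a * conicPlane (a * a) (b * b) (a * b) u w j
              + a * (b * b - γ) * ν w j
            ≈⟨ cancel (a * a * ν u j) (ν w j) (a * b * polar u w j) ⟩
          0# ∎

      P~P′ : SamePoint P P′
      P~P′ = tangential P P′ (apply-nonZero A A-inj (ν-nonZero w≉0)) P∈C P′∈C collinear

      c = proj₁ P~P′

      νx≈cνw : ν x ≈ᵥ (λ j → c * ν w j)
      νx≈cνw = apply-injective A A-inj (λ i → trans (proj₂ (proj₂ P~P′) i) (sym (apply-* A c (ν w) i)))

      x²≈cw² : ∀ r → x r * x r ≈ c * (w r * w r)
      x²≈cw² r = trans (sym (ν-entry x r r)) (trans (νx≈cνw (entry r r)) (*-congˡ (ν-entry w r r)))

      minors : ∀ r s → u r * w s - u s * w r ≈ 0#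
      -- The diagonal gives x r² = c w r², so the squared minor is twice c w r² w s², which is 0.
      minors = pencil-minors≈0 a≉0 λ r s → x*x≈0⇒x≈0 (begin
        (x r * w s - x s * w r) * (x r * w s - x s * w r)
          ≈⟨ [x-y]²≈x²+y² _ _ ⟩
        x r * w s * (x r * w s) + x s * w r * (x s * w r)
          ≈⟨ +-cong (square-product (x r) (w s)) (square-product (x s) (w r)) ⟩
        x r * x r * (w s * w s) + x s * x s * (w r * w r)
          ≈⟨ +-cong (*-congʳ (x²≈cw² r)) (*-congʳ (x²≈cw² s)) ⟩
        c * (w r * w r) * (w s * w s) + c * (w s * w s) * (w r * w r)
          ≈⟨ +-congˡ (solve 3 (λ c p q → c :* p :* q := c :* q :* p) refl c (w s * w s) (w r * w r)) ⟩
        c * (w r * w r) * (w s * w s) + c * (w r * w r) * (w s * w s)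
          ≈⟨ x+x≈0 _ ⟩
        0# ∎)
        where
        square-product : ∀ p q → p * q * (p * q) ≈ p * p * (q * q)
        square-product p q = solve 2 (λ p q → p :* q :* (p :* q) := p :* p :* (q :* q)) refl p q

    -- If α ≠ 0, take a² = α and b = δ/a: then A ν(w), A ν(a u + b w) and the given point of the plane
    -- are collinear, so the line joining them is not a tangent.
    tangential⇒α≈0 : ∀ {u w N α γ δ} → NonZero u → NonZero w → ¬ SamePoint u w →
      N ≈ᵥ apply A (conicPlane α γ δ u w) → Tangential (Conic A u w) N → α ≈ 0#
    tangential⇒α≈0 {u} {w} {N} {α} {γ} {δ} u≉0 w≉0 u≁w N≈ tangential =
      decidable-stable (α ≟ 0#) λ α≉0 →
      let a , a²≈α = square-root α
          a≉0 = x*y≉0⇒x≉0 (λ eq → α≉0 (trans (sym a²≈α) eq))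
          a⁻¹ , aa⁻¹≈1 = inverse a a≉0
          ab≈δ = trans (sym (*-assoc _ _ _)) (trans (*-congʳ aa⁻¹≈1) (*-identityˡ δ))
      in contradiction
        (tangential⇒parallel a (a⁻¹ * δ) a≉0 u≉0 w≉0
          (λ i → trans (N≈ i) (apply-cong A (conicPlane-cong {γ = γ} {u = u} {w} (sym a²≈α) (sym ab≈δ)) i))
          tangential)
        u≁w

    conic-swap : ∀ {u w p} → Conic A u w p → Conic A w u p
    conic-swap {u} {w} (s , t , (r , xr≉0) , c , c≉0 , p≈) =
      t , s , (r , λ eq → xr≉0 (trans (+-comm _ _) eq)) , c , c≉0 ,
      λ i → trans (p≈ i) (*-congˡ (apply-cong A (ν-cong (λ j → +-comm (s * u j) (t * w j))) i))

    conicPlane-swap : ∀ α γ δ u w → conicPlane α γ δ u w ≈ᵥ conicPlane γ α δ w u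
    conicPlane-swap α γ δ u w i = +-cong (+-comm _ _)
      (*-congˡ (trans (+-comm _ _) (+-cong (*-comm _ _) (*-comm _ _))))

    -- In characteristic 2 the symmetric matrices with zero diagonal are the alternating ones; `p`
    -- is the image of such a matrix.
    DiagonalFree : PointSet
    DiagonalFree p = ∃[ n ] (p ≈ᵥ apply A n × (∀ r → n (entry r r) ≈ 0#))

    -- Tangency kills the coefficient of `ν u` and, after exchanging `u` and `w`, that of `ν w`.
    -- What remains is a multiple of `polar u w`.
    nucleus⇒diagonalFree : ∀ {u w N} → NonZero u → NonZero w → ¬ SamePoint u w →
      Nucleus (Conic A u w) N → DiagonalFree N
    nucleus⇒diagonalFree {u} {w} {N} u≉0 w≉0 u≁w (N∈span , _ , tangential) =
      diagonalFree (span-conic⊆conicPlane N∈span)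
      where
      diagonalFree : ConicPlane u w N → DiagonalFree N
      diagonalFree (α , γ , δ , N≈) = conicPlane α γ δ u w , N≈ , λ r → begin
        α * ν u (entry r r) + γ * ν w (entry r r) + δ * polar u w (entry r r)
          ≈⟨ +-cong (+-cong (*-congʳ α≈0) (*-congʳ γ≈0)) (*-congˡ (polar-diagonal u w r)) ⟩
        0# * ν u (entry r r) + 0# * ν w (entry r r) + δ * 0#
          ≈⟨ +-cong (+-cong (zeroˡ _) (zeroˡ _)) (zeroʳ _) ⟩
        0# + 0# + 0#
          ≈⟨ trans (+-identityʳ _) (+-identityʳ _) ⟩
        0# ∎
        where
        α≈0 : α ≈ 0#
        α≈0 = tangential⇒α≈0 u≉0 w≉0 u≁w N≈ tangential
        γ≈0 : γ ≈ 0#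
        γ≈0 = tangential⇒α≈0 w≉0 u≉0 (u≁w ∘ samePoint-sym)
          (λ i → trans (N≈ i) (apply-cong A (conicPlane-swap α γ δ u w) i))
          (λ P P′ P′≉0 P∈C P′∈C → tangential P P′ P′≉0 (conic-swap P∈C) (conic-swap P′∈C))

    ConicNucleus : PointSet
    ConicNucleus N = ∃[ u ] ∃[ w ] (NonZero u × NonZero w × ¬ SamePoint u w × Nucleus (Conic A u w) N)

    nuclearPlane⇒diagonalFree : ∀ {p} → NuclearPlane A p → DiagonalFree p
    nuclearPlane⇒diagonalFree = span-induction {S = ConicNucleus} DiagonalFree zero-case add-case
      (λ { _ (_ , _ , u≉0 , w≉0 , u≁w , nucleus) → nucleus⇒diagonalFree u≉0 w≉0 u≁w nucleus })
      where
      zero-case : ∀ {p} → p ≈ᵥ 0ᵥ → DiagonalFree p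
      zero-case p≈0 = 0ᵥ , (λ i → trans (p≈0 i) (sym (apply-0 A {0ᵥ} (λ _ → refl) i))) , λ _ → refl

      add-case : ∀ {p p₁ p₂} c → DiagonalFree p₁ → DiagonalFree p₂ → (∀ i → p i ≈ c * p₁ i + p₂ i) → DiagonalFree p
      add-case {p} {p₁} {p₂} c (n , p₁≈ , n-diag) (n′ , p₂≈ , n′-diag) p≈ =
        (λ j → c * n j + n′ j) ,
        (λ i → begin
          p i                                   ≈⟨ p≈ i ⟩
          c * p₁ i + p₂ i                       ≈⟨ +-cong (*-congˡ (p₁≈ i)) (p₂≈ i) ⟩
          c * apply A n i + apply A n′ i        ≈⟨ +-congʳ (apply-* A c n i) ⟨
          apply A (λ j → c * n j) i + apply A n′ i ≈⟨ apply-+ A (λ j → c * n j) n′ i ⟨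
          apply A (λ j → c * n j + n′ j) i      ∎) ,
        (λ r → trans (+-cong (trans (*-congˡ (n-diag r)) (zeroʳ c)) (n′-diag r)) (+-identityʳ 0#))

-- Pairs of Veronese cones and uniqueness of sums.

module VeroneseCones {q : ℕ} (F : FiniteField q) where
  open FiniteField F
  open Geometry F
  open FieldProperties F
  open LinearMaps F
  open Cones F
  open import Algebra.Properties.Ring ring using (-1*x≈-x)
  open import Relation.Binary.Reasoning.Setoid setoid

  nonZero-resp : ∀ {n} {u v : Vect n} → u ≈ᵥ v → NonZero u → NonZero v
  nonZero-resp u≈v (i , ui≉0) = i , λ vi≈0 → ui≉0 (trans (u≈v i) vi≈0)

  ImageCone : Matrix → Vect 6 → Set
  ImageCone A p = ∃[ u ] (Cone u × p ≈ᵥ apply A u)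

  module _ (A : Matrix) where

    imageCone-0 : ImageCone A 0ᵥ
    imageCone-0 = 0ᵥ , cone-0 , λ i → sym (apply-0 A {0ᵥ} (λ _ → refl) i)

    imageCone-* : ∀ {p} c → ImageCone A p → ImageCone A (λ i → c * p i)
    imageCone-* c (u , u∈ , p≈) = (λ i → c * u i) , cone-* c u∈ , λ i → trans (*-congˡ (p≈ i)) (sym (apply-* A c u i))

    imageCone-resp : ∀ {p q} → ImageCone A p → (∀ i → q i ≈ p i) → ImageCone A q
    imageCone-resp (u , u∈ , p≈) q≈p = u , u∈ , λ i → trans (q≈p i) (p≈ i)

    imageCone-samePoint : ∀ {p q} → ImageCone A p → SamePoint q p → ImageCone A q
    imageCone-samePoint p∈ (c , _ , q≈cp) = imageCone-resp (imageCone-* c p∈) q≈cp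

    imageCone-neg : ∀ {p} → ImageCone A p → ImageCone A (λ i → - p i)
    imageCone-neg p∈ = imageCone-resp (imageCone-* (- 1#) p∈) (λ i → sym (-1*x≈-x _))

    veronese⇒imageCone : ∀ {p} → Veronese A p → ImageCone A p
    veronese⇒imageCone (v , _ , (x , _ , c , _ , v≈) , d , _ , p≈) =
      (λ i → d * v i) , cone-* d (c , x , v≈) , λ i → trans (p≈ i) (sym (apply-* A d v i))

    imageCone⇒veronese : ∀ {p} → NonZero p → ImageCone A p → Veronese A p
    imageCone⇒veronese {p} p≉0 (u , (c , x , u≈) , p≈) =
      ν x , (i , νxi≉0) , (x , (row i , xi≉0) , 1# , 1≉0 , λ _ → sym (*-identityˡ _)) ,
      c , x*y≉0⇒x≉0 cνxi≉0 , λ j → begin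
        p j                          ≈⟨ p≈ j ⟩
        apply A u j                  ≈⟨ apply-cong A u≈ j ⟩
        apply A (λ k → c * ν x k) j  ≈⟨ apply-* A c (ν x) j ⟩
        c * apply A (ν x) j          ∎
      where
      u≉0 : NonZero u
      u≉0 = apply-nonZero⁻ A (nonZero-resp p≈ p≉0)
      i = proj₁ u≉0
      cνxi≉0 : ¬ c * ν x i ≈ 0#
      cνxi≉0 eq = proj₂ u≉0 (trans (u≈ i) eq)
      νxi≉0 : ¬ ν x i ≈ 0#
      νxi≉0 = x*y≉0⇒y≉0 cνxi≉0
      xi≉0 : ¬ x (row i) ≈ 0#
      xi≉0 = x*y≉0⇒x≉0 (≡.subst (λ t → ¬ t ≈ 0#) (ν-row-col x i) νxi≉0)

  -- The common form of the two parity hypotheses; once it is established, parity no longer enters.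
  UniqueDecomposition : Matrix → Matrix → Set
  UniqueDecomposition A B = ∀ {p q p′ q′} → ImageCone A p → ImageCone B q → ImageCone A p′ → ImageCone B q′ →
    (∀ i → p i + q i ≈ p′ i + q′ i) → p ≈ᵥ p′ × q ≈ᵥ q′

  uniqueDecomposition-sym : ∀ A B → UniqueDecomposition A B → UniqueDecomposition B A
  uniqueDecomposition-sym A B unique q∈ p∈ q′∈ p′∈ eq =
    Product.swap (unique p∈ q∈ p′∈ q′∈ (λ i → trans (+-comm _ _) (trans (eq i) (+-comm _ _))))

  -- The hypothesis concerns the points A (u - v) with `u` and `v` in the cone, and not all points
  -- of the chordal varieties, because for q even these varieties may meet in the nuclear plane.
  disjointSecants⇒unique : ∀ A B → Nonsingular A → Nonsingular B →
    (∀ {u v} → Cone u → Cone v → NonZero (λ i → u i - v i) →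
      ¬ (Chordal A (apply A (λ i → u i - v i)) × Chordal B (apply A (λ i → u i - v i)))) →
    UniqueDecomposition A B
  disjointSecants⇒unique A B A-inj B-inj disjoint {p} {q} {p′} {q′}
    (u , u∈ , p≈) (v , v∈ , q≈) (u′ , u′∈ , p′≈) (v′ , v′∈ , q′≈) eq = conclude (nonZero? m)
    where
    m n : Vect 6
    m i = u i - u′ i
    n i = v′ i - v i

    Am≈Bn : apply A m ≈ᵥ apply B n
    Am≈Bn i = begin
      apply A m i                  ≈⟨ apply-- A u u′ i ⟩
      apply A u i - apply A u′ i   ≈⟨ x+y≈x′+y′⇒x-x′≈y′-y
        (trans (+-cong (sym (p≈ i)) (sym (q≈ i))) (trans (eq i) (+-cong (p′≈ i) (q′≈ i)))) ⟩
      apply B v′ i - apply B v i   ≈⟨ apply-- B v′ v i ⟨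
      apply B n i                  ∎

    m≈0⇒unique : m ≈ᵥ 0ᵥ → p ≈ᵥ p′ × q ≈ᵥ q′
    m≈0⇒unique m≈0 =
      (λ i → trans (p≈ i) (trans (apply-cong A u≈u′ i) (sym (p′≈ i)))) ,
      (λ i → trans (q≈ i) (trans (apply-cong B v≈v′ i) (sym (q′≈ i))))
      where
      u≈u′ : u ≈ᵥ u′
      u≈u′ i = x-y≈0⇒x≈y (m≈0 i)
      n≈0 : n ≈ᵥ 0ᵥ
      n≈0 = B-inj n (λ j → trans (sym (Am≈Bn j)) (apply-0 A m≈0 j))
      v≈v′ : v ≈ᵥ v′
      v≈v′ i = sym (x-y≈0⇒x≈y (n≈0 i))

    conclude : NonZero m ⊎ m ≈ᵥ 0ᵥ → p ≈ᵥ p′ × q ≈ᵥ q′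
    conclude (inj₂ m≈0) = m≈0⇒unique m≈0
    conclude (inj₁ m≉0) = contradiction (m∈A , m∈B) (disjoint u∈ u′∈ m≉0)
      where
      n≉0 : NonZero n
      n≉0 = apply-nonZero⁻ B (nonZero-resp Am≈Bn (apply-nonZero A A-inj m≉0))
      m∈A : Chordal A (apply A m)
      m∈A = m , m≉0 , (m≉0 , detSym-difference {u} {u′} u∈ u′∈) , 1# , 1≉0 , λ i → sym (*-identityˡ (apply A m i))
      m∈B : Chordal B (apply A m)
      m∈B = n , n≉0 , (n≉0 , detSym-difference {v′} {v} v′∈ v∈) , 1# , 1≉0 ,
        λ i → trans (Am≈Bn i) (sym (*-identityˡ (apply B n i)))

  neg⇒samePoint : ∀ {p r : Vect 6} → (∀ i → p i ≈ - r i) → SamePoint p r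
  neg⇒samePoint p≈-r = - 1# , -1≉0 , λ i → trans (p≈-r i) (sym (-1*x≈-x _))

  samePoint-unscale : ∀ {b c} {v w : Vect 6} → ¬ b ≈ 0# → ¬ c ≈ 0# →
    SamePoint (λ i → b * v i) (λ i → c * w i) → SamePoint v w
  samePoint-unscale {b} {c} {v} {w} b≉0 c≉0 (e , e≉0 , eq) with inverse b b≉0
  ... | d , bd≈1 = d * (e * c) , x*y≉0 (x*y≉0⇒y≉0 (λ eq → 1≉0 (trans (sym bd≈1) eq))) (x*y≉0 e≉0 c≉0) , λ i → begin
    v i                ≈⟨ *-identityˡ _ ⟨
    1# * v i           ≈⟨ *-congʳ (trans (sym bd≈1) (*-comm b d)) ⟩
    d * b * v i        ≈⟨ *-assoc _ _ _ ⟩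
    d * (b * v i)      ≈⟨ *-congˡ (eq i) ⟩
    d * (e * (c * w i)) ≈⟨ *-congˡ (*-assoc _ _ _) ⟨
    d * (e * c * w i)  ≈⟨ *-assoc _ _ _ ⟨
    d * (e * c) * w i  ∎

  ZeroSum : Vect 6 → Vect 6 → Vect 6 → Set
  ZeroSum p q r = ∀ i → p i + q i + r i ≈ 0#

  zeroSum⇒q+r≈-p : ∀ {p q r} → ZeroSum p q r → ∀ i → q i + r i ≈ - p i
  zeroSum⇒q+r≈-p {p} {q} {r} sum≈0 i = begin
    q i + r i                       ≈⟨ +-identityˡ _ ⟨
    0# + (q i + r i)                ≈⟨ +-congʳ (-‿inverseˡ (p i)) ⟨
    - p i + p i + (q i + r i)       ≈⟨ trans (+-assoc _ _ _) (+-congˡ (sym (+-assoc _ _ _))) ⟩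
    - p i + (p i + q i + r i)       ≈⟨ +-congˡ (sum≈0 i) ⟩
    - p i + 0#                      ≈⟨ +-identityʳ _ ⟩
    - p i                           ∎

  zeroSum-rotate : ∀ {p q r} → ZeroSum p q r → ZeroSum q r p
  zeroSum-rotate sum≈0 i = trans (+-congʳ (zeroSum⇒q+r≈-p sum≈0 i)) (-‿inverseˡ _)

  zeroSum-swap : ∀ {p q r} → ZeroSum p q r → ZeroSum p r q
  zeroSum-swap sum≈0 i = trans (trans (+-assoc _ _ _) (trans (+-congˡ (+-comm _ _)) (sym (+-assoc _ _ _)))) (sum≈0 i)

  module _ (A B : Matrix) (A-inj : Nonsingular A) (unique : UniqueDecomposition A B) where

    zeroSum-AA : ∀ {p q r} → ImageCone A p ⊎ ImageCone B p → ImageCone A q → ImageCone A r →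
      NonZero q → NonZero r → ZeroSum p q r → SamePoint q r
    zeroSum-AA {p} {q} {r} (inj₁ (u , u∈ , p≈)) (v , v∈ , q≈) (w , w∈ , r≈) q≉0 r≉0 sum≈0 =
      let c , c≉0 , v≈cw = v~w in c , c≉0 , λ i → begin
      q i                          ≈⟨ q≈ i ⟩
      apply A v i                  ≈⟨ apply-cong A v≈cw i ⟩
      apply A (λ j → c * w j) i    ≈⟨ apply-* A c w i ⟩
      c * apply A w i              ≈⟨ *-congˡ (r≈ i) ⟨
      c * r i                      ∎
      where
      v~w : SamePoint v w
      v~w = cone-sum≈0⇒samePoint u∈ v∈ w∈
        (apply-nonZero⁻ A (nonZero-resp q≈ q≉0)) (apply-nonZero⁻ A (nonZero-resp r≈ r≉0))
        (A-inj (λ j → u j + v j + w j) λ i → begin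
          apply A (λ j → u j + v j + w j) i           ≈⟨ apply-+ A (λ j → u j + v j) w i ⟩
          apply A (λ j → u j + v j) i + apply A w i   ≈⟨ +-congʳ (apply-+ A u v i) ⟩
          apply A u i + apply A v i + apply A w i     ≈⟨ +-cong (+-cong (p≈ i) (q≈ i)) (r≈ i) ⟨
          p i + q i + r i                             ≈⟨ sum≈0 i ⟩
          0#                                          ∎)
    -- Uniqueness applied to q + p = -r + 0 yields q = -r.
    zeroSum-AA {p} {q} {r} (inj₂ p∈B) q∈A r∈A _ _ sum≈0 = neg⇒samePoint (proj₁
      (unique q∈A p∈B (imageCone-neg A r∈A) (imageCone-0 B)
        λ i → trans (zeroSum⇒q+r≈-p (zeroSum-swap (zeroSum-rotate (zeroSum-rotate sum≈0))) i) (sym (+-identityʳ _))))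

    -- The sum q + r equals -p + 0 or 0 + (-p), depending on the cone that contains `p`; uniqueness
    -- then makes `r` or `q` vanish.
    zeroSum-AB : ∀ {p q r} → ImageCone A p ⊎ ImageCone B p → ImageCone A q → ImageCone B r →
      NonZero q → NonZero r → ¬ ZeroSum p q r
    zeroSum-AB (inj₁ p∈A) q∈A r∈B _ (i , ri≉0) sum≈0 = ri≉0 (proj₂
      (unique q∈A r∈B (imageCone-neg A p∈A) (imageCone-0 B)
        λ j → trans (zeroSum⇒q+r≈-p sum≈0 j) (sym (+-identityʳ _))) i)
    zeroSum-AB (inj₂ p∈B) q∈A r∈B (i , qi≉0) _ sum≈0 = qi≉0 (proj₁
      (unique q∈A r∈B (imageCone-0 A) (imageCone-neg B p∈B)
        λ j → trans (zeroSum⇒q+r≈-p sum≈0 j) (sym (+-identityˡ _))) i)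

  -- The cap property and completeness of the union.

  module _ (A B : Matrix) (A-inj : Nonsingular A) (B-inj : Nonsingular B) (unique : UniqueDecomposition A B) where

    ConeUnion : Vect 6 → Set
    ConeUnion p = ImageCone A p ⊎ ImageCone B p

    -- As `p` may be zero, this also covers collinearity relations in which one coefficient
    -- vanishes.
    zeroSum⇒samePoint : ∀ {p q r} → ConeUnion p → ConeUnion q → ConeUnion r →
      NonZero q → NonZero r → ZeroSum p q r → SamePoint q r
    zeroSum⇒samePoint p∈ (inj₁ q∈A) (inj₁ r∈A) q≉0 r≉0 sum≈0 = zeroSum-AA A B A-inj unique p∈ q∈A r∈A q≉0 r≉0 sum≈0
    zeroSum⇒samePoint p∈ (inj₁ q∈A) (inj₂ r∈B) q≉0 r≉0 sum≈0 =
      contradiction sum≈0 (zeroSum-AB A B A-inj unique p∈ q∈A r∈B q≉0 r≉0)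
    zeroSum⇒samePoint p∈ (inj₂ q∈B) (inj₁ r∈A) q≉0 r≉0 sum≈0 =
      contradiction (zeroSum-swap sum≈0) (zeroSum-AB A B A-inj unique p∈ r∈A q∈B r≉0 q≉0)
    zeroSum⇒samePoint p∈ (inj₂ q∈B) (inj₂ r∈B) q≉0 r≉0 sum≈0 =
      zeroSum-AA B A B-inj (uniqueDecomposition-sym A B unique) (swap p∈) q∈B r∈B q≉0 r≉0 sum≈0

    union⇒coneUnion : ∀ {p} c → (Veronese A ∪ Veronese B) p → ConeUnion (λ i → c * p i)
    union⇒coneUnion c = map (imageCone-* A c ∘ veronese⇒imageCone A) (imageCone-* B c ∘ veronese⇒imageCone B)

    scale-nonZero : ∀ {b} {v : Vect 6} → ¬ b ≈ 0# → NonZero v → NonZero (λ i → b * v i)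
    scale-nonZero b≉0 (i , vi≉0) = i , x*y≉0 b≉0 vi≉0

    pair : ∀ a b c u v w → (Veronese A ∪ Veronese B) u → (Veronese A ∪ Veronese B) v → (Veronese A ∪ Veronese B) w →
      NonZero v → NonZero w → ¬ b ≈ 0# → ¬ c ≈ 0# →
      ZeroSum (λ i → a * u i) (λ i → b * v i) (λ i → c * w i) → SamePoint v w
    pair a b c u v w u∈ v∈ w∈ v≉0 w≉0 b≉0 c≉0 sum≈0 = samePoint-unscale {b} {c} {v} {w} b≉0 c≉0
      (zeroSum⇒samePoint {λ i → a * u i} {λ i → b * v i} {λ i → c * w i}
        (union⇒coneUnion a u∈) (union⇒coneUnion b v∈) (union⇒coneUnion c w∈)
        (scale-nonZero b≉0 v≉0) (scale-nonZero c≉0 w≉0) sum≈0)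

    lone : ∀ a b c (u v w : Vect 6) → ¬ a ≈ 0# → NonZero u → b ≈ 0# → c ≈ 0# →
      ¬ ZeroSum (λ i → a * u i) (λ i → b * v i) (λ i → c * w i)
    lone a b c u v w a≉0 (i , ui≉0) b≈0 c≈0 sum≈0 = x*y≉0 a≉0 ui≉0 (begin
      a * u i                          ≈⟨ trans (+-identityʳ _) (+-identityʳ _) ⟨
      a * u i + 0# + 0#                ≈⟨ +-cong (+-congˡ (trans (*-congʳ b≈0) (zeroˡ _)))
                                            (trans (*-congʳ c≈0) (zeroˡ _)) ⟨
      a * u i + b * v i + c * w i      ≈⟨ sum≈0 i ⟩
      0#                               ∎)

    union-cap : Cap (Veronese A ∪ Veronese B)
    union-cap u v w u≉0 v≉0 w≉0 u∈ v∈ w∈ u≁v u≁w v≁w (a , b , c , some≉0 , sum≈0) =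
      cases (a ≟ 0#) (b ≟ 0#) (c ≟ 0#)
      where
      au bv cw : Vect 6
      au i = a * u i
      bv i = b * v i
      cw i = c * w i

      bv+cw+au≈0 : ZeroSum bv cw au
      bv+cw+au≈0 = zeroSum-rotate {au} {bv} {cw} sum≈0

      cw+au+bv≈0 : ZeroSum cw au bv
      cw+au+bv≈0 = zeroSum-rotate {bv} {cw} {au} bv+cw+au≈0

      -- Two nonzero coefficients identify their points whatever the third coefficient is; a single
      -- one would make its vector vanish.
      cases : Dec (a ≈ 0#) → Dec (b ≈ 0#) → Dec (c ≈ 0#) → ⊥
      cases (yes a≈0) (yes b≈0) (yes c≈0) = [ contradiction a≈0 , [ contradiction b≈0 , contradiction c≈0 ]′ ]′ some≉0
      cases (no a≉0)  (yes b≈0) (yes c≈0) = lone a b c u v w a≉0 u≉0 b≈0 c≈0 sum≈0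
      cases (yes a≈0) (no b≉0)  (yes c≈0) = lone b c a v w u b≉0 v≉0 c≈0 a≈0 bv+cw+au≈0
      cases (yes a≈0) (yes b≈0) (no c≉0)  = lone c a b w u v c≉0 w≉0 a≈0 b≈0 cw+au+bv≈0
      cases _         (no b≉0)  (no c≉0)  = v≁w (pair a b c u v w u∈ v∈ w∈ v≉0 w≉0 b≉0 c≉0 sum≈0)
      cases (no a≉0)  (no b≉0)  _         = u≁v (pair c a b w u v w∈ u∈ v∈ u≉0 v≉0 a≉0 b≉0 cw+au+bv≈0)
      cases (no a≉0)  _         (no c≉0)  =
        u≁w (samePoint-sym (pair b c a v w u v∈ w∈ u∈ w≉0 u≉0 c≉0 a≉0 bv+cw+au≈0))

    -- Splitting six coordinates into two triples, one for each cone, makes the sum map an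
    -- endofunction of `Vect 6`, so finiteness applies without computing the size of a cone.
    decompose : ∀ p → ∃[ u ] ∃[ v ] (ImageCone A u × ImageCone B v × (∀ i → u i + v i ≈ p i))
    decompose p = conclude (≈ᵥ-injective⇒surjective Ψ Ψ-injective p)
      where
      first second : Vect 6 → Vect 3
      first  s r = s (r ↑ˡ 3)
      second s r = s (3 ↑ʳ r)

      imageφ : ∀ M v → ImageCone M (apply M (φ v))
      imageφ M v = φ v , φ-cone v , λ _ → refl

      Ψ : Vect 6 → Vect 6
      Ψ s i = apply A (φ (first s)) i + apply B (φ (second s)) i

      Ψ-injective : ∀ {s t} → Ψ s ≈ᵥ Ψ t → s ≈ᵥ t
      Ψ-injective {s} {t} eq =
        let eqA , eqB = unique (imageφ A (first s)) (imageφ B (second s)) (imageφ A (first t)) (imageφ B (second t)) eq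
        in halves (φ-injective (apply-injective A A-inj eqA)) (φ-injective (apply-injective B B-inj eqB))
        where
        halves : first s ≈ᵥ first t → second s ≈ᵥ second t → s ≈ᵥ t
        halves first≈ second≈ = λ where
          0F → first≈ 0F
          1F → first≈ 1F
          2F → first≈ 2F
          3F → second≈ 0F
          4F → second≈ 1F
          5F → second≈ 2F

      conclude : ∃[ s ] Ψ s ≈ᵥ p → ∃[ u ] ∃[ v ] (ImageCone A u × ImageCone B v × (∀ i → u i + v i ≈ p i))
      conclude (s , eq) = apply A (φ (first s)) , apply B (φ (second s)) , imageφ A (first s) , imageφ B (second s) , eq

    union-complete : ∀ p → NonZero p → ¬ (Veronese A ∪ Veronese B) p → ¬ Cap (Add (Veronese A ∪ Veronese B) p)
    union-complete p p≉0 p∉ cap =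
      let u , v , u∈A , v∈B , u+v≈p = decompose p in refute u∈A v∈B u+v≈p (nonZero? u) (nonZero? v)
      where
      p∉A : ¬ ImageCone A p
      p∉A = p∉ ∘ inj₁ ∘ imageCone⇒veronese A p≉0
      p∉B : ¬ ImageCone B p
      p∉B = p∉ ∘ inj₂ ∘ imageCone⇒veronese B p≉0

      refute : ∀ {u v} → ImageCone A u → ImageCone B v → (∀ i → u i + v i ≈ p i) →
        NonZero u ⊎ u ≈ᵥ 0ᵥ → NonZero v ⊎ v ≈ᵥ 0ᵥ → ⊥
      -- A zero summand would place `p` itself on one of the surfaces.
      refute u∈A v∈B u+v≈p (inj₂ u≈0) _ = p∉B (imageCone-resp B v∈B λ i →
        trans (sym (u+v≈p i)) (trans (+-congʳ (u≈0 i)) (+-identityˡ _)))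
      refute u∈A v∈B u+v≈p _ (inj₂ v≈0) = p∉A (imageCone-resp A u∈A λ i →
        trans (sym (u+v≈p i)) (trans (+-congˡ (v≈0 i)) (+-identityʳ _)))
      refute {u} {v} u∈A v∈B u+v≈p (inj₁ u≉0) (inj₁ v≉0) = cap u v p u≉0 v≉0 p≉0
        (inj₁ (inj₁ (imageCone⇒veronese A u≉0 u∈A)))
        (inj₁ (inj₂ (imageCone⇒veronese B v≉0 v∈B)))
        (inj₂ (1# , 1≉0 , λ _ → sym (*-identityˡ _)))
        u≁v (p∉A ∘ imageCone-samePoint A u∈A ∘ samePoint-sym) (p∉B ∘ imageCone-samePoint B v∈B ∘ samePoint-sym)
        (1# , 1# , - 1# , inj₁ 1≉0 , λ i → begin
          1# * u i + 1# * v i + - 1# * p i  ≈⟨ +-cong (+-cong (*-identityˡ _) (*-identityˡ _)) (-1*x≈-x _) ⟩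
          u i + v i - p i                   ≈⟨ +-congʳ (u+v≈p i) ⟩
          p i - p i                         ≈⟨ -‿inverseʳ _ ⟩
          0#                                ∎)
        where
        u≁v : ¬ SamePoint u v
        -- Read u = c v as u + 0 = 0 + c v; uniqueness then gives u = 0.
        u≁v (c , _ , u≈cv) = proj₂ u≉0 (proj₁
          (unique u∈A (imageCone-0 B) (imageCone-0 A) (imageCone-* B c v∈B)
            (λ i → trans (+-identityʳ _) (trans (u≈cv i) (sym (+-identityˡ _))))) _)

    union-completeCap : CompleteCap (Veronese A ∪ Veronese B)
    union-completeCap = union-cap , union-complete

-- Deduction from the hypotheses for each parity.

theorem4p8 : (q p k : ℕ) → Prime p → q ≡ p ^ suc k → 2 < q →
    (F : FiniteField q) → let open Geometry F in
    (A B : Matrix) → Nonsingular A → Nonsingular B →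
    (¬ (2 ∣ q) → ∀ x → ¬ (Chordal A x × Chordal B x)) →
    (2 ∣ q →
    (∀ x → (NuclearPlane A x → NuclearPlane B x) × (NuclearPlane B x → NuclearPlane A x)) ×
    (∀ x → Chordal A x → Chordal B x → NuclearPlane A x)) →
    CompleteCap (Veronese A ∪ Veronese B)
theorem4p8 q p k p-prime q≡p^1+k _ F A B A-inj B-inj odd-case even-case =
  union-completeCap A B A-inj B-inj (disjointSecants⇒unique A B A-inj B-inj (disjoint (2 ∣? q)))
  where
  open FiniteField F
  open Geometry F
  open FieldProperties F
  open LinearMaps F
  open Cones F
  open VeroneseCones F

  disjoint : Dec (2 ∣ q) → ∀ {u v} → Cone u → Cone v → NonZero (λ i → u i - v i) →
    ¬ (Chordal A (apply A (λ i → u i - v i)) × Chordal B (apply A (λ i → u i - v i)))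
  disjoint (no 2∤q) {u} {v} _ _ _ chordal = odd-case 2∤q (apply A (λ i → u i - v i)) chordal
  disjoint (yes 2∣q) {u} {v} u∈ v∈ (i , ui-vi≉0) (p∈A , p∈B) =
    ui-vi≉0 (trans (+-congʳ (u≈v i)) (-‿inverseʳ _))
    where
    open Characteristic2 F (even-order⇒x+x≈0 (suc k) p-prime q≡p^1+k 2∣q)

    diagonalFree : DiagonalFree A A-inj (apply A (λ i → u i - v i))
    diagonalFree = nuclearPlane⇒diagonalFree A A-inj (proj₂ (even-case 2∣q) _ p∈A p∈B)

    u≈v : u ≈ᵥ v
    u≈v =
      let n , An≈ , n-diagonal = diagonalFree
          -- The nuclear plane yields some preimage `n` with zero diagonal; injectivity of `A`
          -- identifies it with u - v.
          u-v≈n = apply-injective A A-inj {λ i → u i - v i} {n} An≈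
      in cone-diagonal-injective u∈ v∈ λ r → x-y≈0⇒x≈y (trans (u-v≈n (entry r r)) (n-diagonal r))
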